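{- Let $\alpha>0$ be a constant. There is a constant $c>0$ depending only on $\alpha$ such that the following holds. Let $G$ be an $n$-vertex graph in which every two distinct vertices have at least $\alpha n$ common neighbours. Then in the RandomWalker game on $G$, for any strategy of Breaker, with high probability (i.e. with probability tending to $1$ as $n\to\infty$) RandomWalker visits all but at most $c\log n$ vertices of $G$.
   Context: The RandomWalker game on a graph $G$: RandomWalker starts at a vertex of $G$ (which counts as visited), and moves alternate with Breaker's moves. On Breaker's move he acquires one edge of $G$ (not yet traversed by the walker). On RandomWalker's move, if she is at vertex $v$, she moves to a neighbour $w$ of $v$ chosen uniformly at random among those $w$ for which the edge $vw$ has not been acquired by Breaker; $w$ becomes visited. The game ends when there is no path from RandomWalker's current position to an unvisited vertex along edges not acquired by Breaker. Breaker aims to minimize the number of vertices visited. -}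

module Defs where

open import Data.Bool using (Bool; true; false; _∧_; _∨_; not; if_then_else_)
open import Data.Nat using (ℕ; zero; suc; _*_)
open import Data.Fin using (Fin)
import Data.Fin as Fin
open import Data.Bool.ListAction using (any)
open import Data.List using (List; []; _∷_; filter; length; allFin; concatMap; map; sum)
import Data.List as List
open import Data.Product using (_×_; _,_)
open import Data.Rational using (ℚ; 0ℚ; 1ℚ; _+_; _*_; _≤_; _/_)
import Data.Rational as ℚ
open import Data.Integer using (+_)
open import Relation.Nullary.Decidable using (⌊_⌋)
open import Relation.Binary.PropositionalEquality using (_≡_)

record Graph (n : ℕ) : Set where
  field
    adj    : Fin n → Fin n → Bool
    sym    : ∀ u v → adj u v ≡ adj v u
    irrefl : ∀ u → adj u u ≡ false
open Graph public

_==_ : ∀ {n} → Fin n → Fin n → Bool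
u == v = ⌊ u Fin.≟ v ⌋

codeg : ∀ {n} → Graph n → Fin n → Fin n → ℕ
codeg {n} G u v = length (filter (λ w → adj G u w ∧ adj G v w Data.Bool.≟ true) (allFin n))
  where import Data.Bool

CodegreeAtLeast : ∀ {n} → ℚ → Graph n → Set
CodegreeAtLeast {n} α G =
  ∀ u v → ¬ (u ≡ v) → α ℚ.* (+ n / 1) ≤ (+ codeg G u v / 1)
  where open import Relation.Nullary using (¬_)

Edge : ℕ → Set
Edge n = Fin n × Fin n

memE : ∀ {n} → List (Edge n) → Fin n → Fin n → Bool
memE es u v = any (λ { (a , b) → ((a == u) ∧ (b == v)) ∨ ((a == v) ∧ (b == u)) }) es

-- A Breaker strategy: given the walker's full history (most recent
-- position first) and Breaker's previously acquired edges (most recent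
-- first), name an edge to acquire.  An illegal answer is replaced by the
-- lexicographically first legal edge (so effective strategies are exactly
-- the legal strategies).
Strategy : ℕ → Set
Strategy n = List (Fin n) → List (Edge n) → Edge n

record State (n : ℕ) : Set where
  constructor st
  field
    pos  : Fin n
    hist : List (Fin n)      -- walker positions, most recent first (contains pos)
    acq  : List (Edge n)
    trav : List (Edge n)
open State public

module _ {n : ℕ} (G : Graph n) where

  visited : State n → Fin n → Bool
  visited s v = any (_== v) (hist s)

  visitedCount : State n → ℕ
  visitedCount s = length (filter (λ v → visited s v Data.Bool.≟ true) (allFin n))
    where import Data.Bool

  openE : State n → Fin n → Fin n → Bool
  openE s u v = adj G u v ∧ not (memE (acq s) u v)

  reachK : ℕ → State n → Fin n → Bool
  reachK zero    s v = pos s == v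
  reachK (suc k) s v = reachK k s v ∨ any (λ u → reachK k s u ∧ openE s u v) (allFin n)

  reachable : State n → Fin n → Bool
  reachable s = reachK n s

  over : State n → Bool
  over s = not (any (λ v → reachable s v ∧ not (visited s v)) (allFin n))

  available : State n → Fin n → Fin n → Bool
  available s u v = adj G u v ∧ not (memE (acq s) u v) ∧ not (memE (trav s) u v)

  allEdges : List (Edge n)
  allEdges = concatMap (λ u → map (λ v → (u , v)) (allFin n)) (allFin n)

  breakerMove : Strategy n → State n → State n
  breakerMove B s with B (hist s) (acq s)
  ... | (u , v) = if available s u v then record s { acq = (u , v) ∷ acq s } else fallback
    where
    fallback : State n
    fallback with filter (λ { (a , b) → available s a b Data.Bool.≟ true }) allEdges
      where import Data.Bool
    ... | []    = s
    ... | e ∷ _ = record s { acq = e ∷ acq s }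

  walkTo : State n → Fin n → State n
  walkTo s w = st w (w ∷ hist s) (acq s) ((pos s , w) ∷ trav s) 

  indicator : (ℕ → Bool) → State n → ℚ
  indicator E s = if E (visitedCount s) then 1ℚ else 0ℚ

  -- Probability that the number of visited vertices at the end of the game
  -- satisfies E.  One round = Breaker move, then a RandomWalker move; the
  -- end-of-game condition is checked before every move.  The fuel argument
  -- only bounds the recursion; n * n + 1 rounds always suffice, since each
  -- round in which the game continues Breaker acquires a new edge.
  probK : ℕ → Strategy n → (ℕ → Bool) → State n → ℚ
  probK zero    B E s = indicator E s
  probK (suc k) B E s =
    if over s then indicator E s else afterBreaker (breakerMove B s)
    where
    walkerStep : State n → ℚ
    walkerStep s' with filter (λ w → openE s' (pos s') w Data.Bool.≟ true) (allFin n)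
      where import Data.Bool
    ... | []          = indicator E s'
    ... | ws@(_ ∷ ws') =
      List.foldr _+_ 0ℚ (map (λ w → (+ 1 / suc (length ws')) ℚ.* probK k B E (walkTo s' w)) ws)
    afterBreaker : State n → ℚ
    afterBreaker s' = if over s' then indicator E s' else walkerStep s'

  gameProb : Strategy n → Fin n → (ℕ → Bool) → ℚ
  gameProb B v E = probK (suc (n Data.Nat.* n)) B E (st v (v ∷ []) [] [])
    where import Data.Nat

{-# OPTIONS --safe #-}

-- Call a vertex bad once Breaker has acquired n / 4A of its edges, where 1 / A ≤ α.
-- During the first T = Θ(n log n) rounds at most L = O(log n) vertices are bad.
-- Between good vertices there are Ω(n) open paths of length two, so while
-- u > 2L vertices are unvisited, the second of two moves from a good vertex visits
-- one of them with probability Ω(u / n).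
-- Hence the expected number of unvisited vertices, measured one move ahead,
-- decays by a factor 1 - Ω(1 / n) in each round started at a good vertex.
--
-- It remains to see that the walker is rarely delayed at bad vertices.  A vertex of
-- open degree more than D = polylog n leads to a bad vertex with probability
-- at most L / D, so two bad vertices in a row are unlikely, and with at most one
-- bad vertex out of two, half of the decay survives.  The walker reaches a
-- vertex of open degree at most D with probability O(D L / n²) per two moves, since
-- these vertices have at most D L open edges in total.  The failure probability is
-- bounded by a potential combining these three contributions, by induction on
-- the number of rounds left.
module Submission where

open import Data.Bool using (Bool; true; false; _∧_; _∨_; not; if_then_else_)
import Data.Bool as Bool
open import Data.Bool.ListAction using (any)
open import Data.Bool.Properties using (∨-comm; ∨-zeroʳ; T-≡)
open import Data.Fin using (Fin; zero; suc)
import Data.Fin as Fin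
import Data.Integer as ℤ
import Data.Integer.Properties as ℤₚ
open import Data.List using (List; []; _∷_; filter; length; allFin; map; foldr; tabulate)
open import Data.List.Membership.Propositional using (lose)
open import Data.List.Membership.Propositional.Properties using (∈-allFin)
open import Data.List.Properties using (length-tabulate)
open import Data.List.Relation.Unary.Any.Properties using (any⁺)
open import Data.Nat hiding (_/_)
import Data.Nat as ℕ
open import Data.Nat.DivMod using (m*n/n≡m; /-monoˡ-≤; m/n*n≤m; m≡m%n+[m/n]*n; m%n<n)
open import Data.Nat.Induction using (<-rec)
open import Data.Nat.Logarithm using (⌊log₂_⌋; ⌊log₂⌋-mono-≤; ⌊log₂[2^n]⌋≡n; ⌊log₂⌊n/2⌋⌋≡⌊log₂n⌋∸1)
open import Data.Nat.Properties
open import Data.Nat.Tactic.RingSolver using (solve-∀)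
open import Data.Product using (Σ; ∃; _×_; _,_; proj₁; proj₂)
open import Data.Rational using (ℚ; 0ℚ; 1ℚ; _/_; mkℚ)
import Data.Rational as ℚ
import Data.Rational.Properties as ℚₚ
open import Data.Rational.Unnormalised using (mkℚᵘ; *≡*; *≤*)
import Data.Rational.Unnormalised as ℚᵘ
import Data.Rational.Unnormalised.Properties as ℚᵘₚ
open import Data.Sum using (_⊎_; inj₁; inj₂)
open import Function using (_∘_; id; Equivalence)
open import Relation.Binary.PropositionalEquality
  using (_≡_; _≢_; refl; sym; trans; cong; cong₂; subst; subst₂)
open import Relation.Nullary using (Dec; ¬_; yes; no; contradiction)
open import Relation.Nullary.Decidable using (⌊_⌋; dec⇒maybe)
import Tactic.RingSolver as Solver
open import Tactic.RingSolver.Core.AlmostCommutativeRing using (AlmostCommutativeRing; fromCommutativeRing)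

open import Defs renaming (sym to adj-sym)

-- Finite sums of natural numbers

∑ : ∀ {A : Set} → List A → (A → ℕ) → ℕ
∑ []       f = 0
∑ (x ∷ xs) f = f x + ∑ xs f

syntax ∑ xs (λ x → e) = ∑[ x ∈ xs ] e

⟦_⟧ : Bool → ℕ
⟦ true ⟧  = 1
⟦ false ⟧ = 0

⟦⟧≤1 : ∀ b → ⟦ b ⟧ ≤ 1
⟦⟧≤1 true  = ≤-refl
⟦⟧≤1 false = z≤n

⟦⟧-positive : ∀ {b} → 1 ≤ ⟦ b ⟧ → b ≡ true
⟦⟧-positive {true} _ = refl

module _ {A : Set} where

  ∑-mono : ∀ (xs : List A) {f g} → (∀ x → f x ≤ g x) → ∑ xs f ≤ ∑ xs g
  ∑-mono []       f≤g = z≤n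
  ∑-mono (x ∷ xs) f≤g = +-mono-≤ (f≤g x) (∑-mono xs f≤g)

  ∑-cong : ∀ (xs : List A) {f g} → (∀ x → f x ≡ g x) → ∑ xs f ≡ ∑ xs g
  ∑-cong []       f≡g = refl
  ∑-cong (x ∷ xs) f≡g = cong₂ _+_ (f≡g x) (∑-cong xs f≡g)

  ∑-+ : ∀ (xs : List A) f g → ∑[ x ∈ xs ] (f x + g x) ≡ ∑ xs f + ∑ xs g
  ∑-+ []       f g = refl
  ∑-+ (x ∷ xs) f g rewrite ∑-+ xs f g = interchange (f x) (g x) (∑ xs f) (∑ xs g)
    where
    interchange : ∀ a b c d → a + b + (c + d) ≡ a + c + (b + d)
    interchange = solve-∀

  ∑-*ˡ : ∀ (xs : List A) c f → ∑[ x ∈ xs ] (c * f x) ≡ c * ∑ xs f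
  ∑-*ˡ []       c f = sym (*-zeroʳ c)
  ∑-*ˡ (x ∷ xs) c f rewrite ∑-*ˡ xs c f = sym (*-distribˡ-+ c (f x) _)

  ∑-*ʳ : ∀ (xs : List A) c f → ∑[ x ∈ xs ] (f x * c) ≡ ∑ xs f * c
  ∑-*ʳ xs c f = trans (∑-cong xs (λ x → *-comm (f x) c)) (trans (∑-*ˡ xs c f) (*-comm c _))

  ∑-positive : ∀ (xs : List A) {f} → 1 ≤ ∑ xs f → ∃ λ x → 1 ≤ f x
  ∑-positive (x ∷ xs) {f} p with f x in eq
  ... | suc _ = x , ≤-trans (s≤s z≤n) (≤-reflexive (sym eq))
  ... | zero  = ∑-positive xs p

  length-filter-∑ : ∀ (p : A → Bool) xs →
    length (filter (λ x → p x Bool.≟ true) xs) ≡ ∑[ x ∈ xs ] ⟦ p x ⟧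
  length-filter-∑ p []       = refl
  length-filter-∑ p (x ∷ xs) with p x
  ... | true  = cong suc (length-filter-∑ p xs)
  ... | false = length-filter-∑ p xs

  ∑-filter : ∀ (p : A → Bool) xs f →
    ∑ (filter (λ x → p x Bool.≟ true) xs) f ≡ ∑[ x ∈ xs ] (⟦ p x ⟧ * f x)
  ∑-filter p []       f = refl
  ∑-filter p (x ∷ xs) f with p x
  ... | true  = cong₂ _+_ (sym (*-identityˡ (f x))) (∑-filter p xs f)
  ... | false = ∑-filter p xs f

  ∑-one : ∀ (xs : List A) → ∑[ x ∈ xs ] 1 ≡ length xs
  ∑-one []       = refl
  ∑-one (x ∷ xs) = cong suc (∑-one xs)

  ∑-zero : ∀ (xs : List A) → ∑[ x ∈ xs ] 0 ≡ 0
  ∑-zero []       = refl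
  ∑-zero (x ∷ xs) = ∑-zero xs

∑-swap : ∀ {A B : Set} (xs : List A) (ys : List B) (f : A → B → ℕ) →
  ∑[ x ∈ xs ] ∑ ys (f x) ≡ ∑[ y ∈ ys ] ∑[ x ∈ xs ] f x y
∑-swap []       ys f = sym (∑-zero ys)
∑-swap (x ∷ xs) ys f rewrite ∑-swap xs ys f = sym (∑-+ ys (f x) _)

∑-tabulate : ∀ {n} {A : Set} (g : Fin n → A) f → ∑ (tabulate g) f ≡ ∑ (allFin n) (f ∘ g)
∑-tabulate {zero}  g f = refl
∑-tabulate {suc n} g f =
  cong (f (g zero) +_) (trans (∑-tabulate (g ∘ suc) f) (sym (∑-tabulate suc (f ∘ g))))

suc-== : ∀ {n} (u v : Fin n) → (suc u == suc v) ≡ (u == v)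
suc-== u v with u Fin.≟ v
... | yes _ = refl
... | no _  = refl

∑-delta : ∀ {n} (v : Fin n) (f : Fin n → ℕ) → ∑[ x ∈ allFin n ] (⟦ v == x ⟧ * f x) ≡ f v
∑-delta {suc n} zero f =
  trans (cong₂ _+_ (*-identityˡ (f zero)) (trans (∑-tabulate {n} suc _) (∑-zero (allFin n)))) (+-identityʳ _)
∑-delta {suc n} (suc v) f = trans (∑-tabulate {n} suc _) 
  (trans (∑-cong (allFin n) (λ x → cong (λ b → ⟦ b ⟧ * f (suc x)) (suc-== v x)))
         (∑-delta v (f ∘ suc)))

-- Degrees under a set of acquired edges

⟦∧⟧ : ∀ a b → ⟦ a ∧ b ⟧ ≡ ⟦ a ⟧ * ⟦ b ⟧
⟦∧⟧ true  b = sym (+-identityʳ ⟦ b ⟧)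
⟦∧⟧ false b = refl

⟦∨⟧≤ : ∀ a b → ⟦ a ∨ b ⟧ ≤ ⟦ a ⟧ + ⟦ b ⟧
⟦∨⟧≤ true  b = s≤s z≤n
⟦∨⟧≤ false b = ≤-refl

memE-sym : ∀ {n} (es : List (Edge n)) u v → memE es u v ≡ memE es v u
memE-sym []             u v = refl
memE-sym ((a , b) ∷ es) u v =
  cong₂ _∨_ (∨-comm ((a == u) ∧ (b == v)) ((a == v) ∧ (b == u))) (memE-sym es u v)

module _ {n : ℕ} where

  ∑-==≡1 : ∀ (v : Fin n) → ∑[ x ∈ allFin n ] ⟦ v == x ⟧ ≡ 1
  ∑-==≡1 v = trans (∑-cong (allFin n) (λ x → sym (*-identityʳ ⟦ v == x ⟧))) (∑-delta v (λ _ → 1))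

  -- Both orientations are counted, even for a loop, so that a row sum is exactly the number of
  -- endpoints equal to `u`.
  hits : Edge n → Fin n → Fin n → ℕ
  hits (a , b) u v = ⟦ a == u ⟧ * ⟦ b == v ⟧ + ⟦ b == u ⟧ * ⟦ a == v ⟧

  ∑-hits : ∀ e u → ∑ (allFin n) (hits e u) ≡ ⟦ proj₁ e == u ⟧ + ⟦ proj₂ e == u ⟧
  ∑-hits (a , b) u = trans (∑-+ (allFin n) _ _) (cong₂ _+_ (half a b) (half b a))
    where
    half : ∀ a b → ∑[ v ∈ allFin n ] (⟦ a == u ⟧ * ⟦ b == v ⟧) ≡ ⟦ a == u ⟧
    half a b = trans (∑-*ˡ (allFin n) ⟦ a == u ⟧ _)
                     (trans (cong (⟦ a == u ⟧ *_) (∑-==≡1 b)) (*-identityʳ _))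

  ∑-hits≤2 : ∀ e u → ∑ (allFin n) (hits e u) ≤ 2
  ∑-hits≤2 e u = ≤-trans (≤-reflexive (∑-hits e u)) (+-mono-≤ (⟦⟧≤1 (proj₁ e == u)) (⟦⟧≤1 (proj₂ e == u)))

  mem : List (Edge n) → Fin n → Fin n → ℕ
  mem es u v = ⟦ memE es u v ⟧

  mem-∷ : ∀ e es u v → mem (e ∷ es) u v ≤ hits e u v + mem es u v
  mem-∷ (a , b) es u v = ≤-trans (⟦∨⟧≤ _ (memE es u v)) (+-monoˡ-≤ (mem es u v)
    (≤-trans (⟦∨⟧≤ ((a == u) ∧ (b == v)) ((a == v) ∧ (b == u)))
      (≤-reflexive (cong₂ _+_ (⟦∧⟧ (a == u) (b == v))
        (trans (⟦∧⟧ (a == v) (b == u)) (*-comm ⟦ a == v ⟧ ⟦ b == u ⟧))))))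

  bdeg : List (Edge n) → Fin n → ℕ
  bdeg es u = ∑ (allFin n) (mem es u)

  bdeg-∷ : ∀ e es u → bdeg (e ∷ es) u ≤ ∑ (allFin n) (hits e u) + bdeg es u
  bdeg-∷ e es u = ≤-trans (∑-mono (allFin n) (mem-∷ e es u)) (≤-reflexive (∑-+ (allFin n) _ _))

  -- Handshake count: each acquired edge contributes its two endpoints.
  ∑-bdeg : ∀ es → ∑ (allFin n) (bdeg es) ≤ 2 * length es
  ∑-bdeg []             = ≤-reflexive (trans (∑-cong (allFin n) (λ _ → ∑-zero (allFin n))) (∑-zero (allFin n)))
  ∑-bdeg (e@(a , b) ∷ es) = begin
    ∑ (allFin n) (bdeg (e ∷ es))
      ≤⟨ ∑-mono (allFin n) (bdeg-∷ e es) ⟩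
    ∑[ u ∈ allFin n ] (∑ (allFin n) (hits e u) + bdeg es u)
      ≡⟨ ∑-+ (allFin n) _ _ ⟩
    ∑[ u ∈ allFin n ] ∑ (allFin n) (hits e u) + ∑ (allFin n) (bdeg es)
      ≡⟨ cong (_+ _) (trans (∑-cong (allFin n) (∑-hits e)) (trans (∑-+ (allFin n) _ _) (cong₂ _+_ (∑-==≡1 a) (∑-==≡1 b)))) ⟩
    2 + ∑ (allFin n) (bdeg es)
      ≤⟨ +-monoʳ-≤ 2 (∑-bdeg es) ⟩
    2 + 2 * length es
      ≡⟨ sym (*-suc 2 (length es)) ⟩
    2 * suc (length es) ∎
    where open ≤-Reasoning

  -- Counting unvisited vertices

  unv : List (Fin n) → Fin n → ℕ
  unv h x = ⟦ not (any (_== x) h) ⟧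

  #unv : List (Fin n) → ℕ
  #unv h = ∑ (allFin n) (unv h)

  unv-∷ : ∀ w h x → unv (w ∷ h) x + ⟦ w == x ⟧ * unv h x ≡ unv h x
  unv-∷ w h x with w == x
  ... | true  = +-identityʳ _
  ... | false = +-identityʳ _

  #unv-∷ : ∀ w h → #unv (w ∷ h) + unv h w ≡ #unv h
  #unv-∷ w h = trans (cong (#unv (w ∷ h) +_) (sym (∑-delta w (unv h))))
    (trans (sym (∑-+ (allFin n) _ _)) (∑-cong (allFin n) (unv-∷ w h)))

  ∑-≤1 : ∀ {f : Fin n → ℕ} → (∀ x → f x ≤ 1) → ∑ (allFin n) f ≤ n
  ∑-≤1 f≤1 = ≤-trans (∑-mono (allFin n) f≤1)
    (≤-reflexive (trans (∑-one (allFin n)) (length-tabulate id)))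

  #unv≤n : ∀ h → #unv h ≤ n
  #unv≤n h = ∑-≤1 (λ x → ⟦⟧≤1 _)

-- Open degrees and open paths of length two

module _ {n : ℕ} (G : Graph n) where

  opn : List (Edge n) → Fin n → Fin n → ℕ
  opn es u v = ⟦ adj G u v ∧ not (memE es u v) ⟧

  opn-sym : ∀ es u v → opn es u v ≡ opn es v u
  opn-sym es u v = cong ⟦_⟧ (cong₂ (λ a b → a ∧ not b) (adj-sym G u v) (memE-sym es u v))

  opn-irrefl : ∀ es u → opn es u u ≡ 0
  opn-irrefl es u rewrite irrefl G u = refl

  opn≤1 : ∀ es u v → opn es u v ≤ 1
  opn≤1 es u v = ⟦⟧≤1 _

  adj≤ : ∀ es u v → ⟦ adj G u v ⟧ ≤ opn es u v + mem es u v
  adj≤ es u v with adj G u v | memE es u v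
  ... | true  | true  = ≤-refl
  ... | true  | false = ≤-refl
  ... | false | _     = z≤n

  odeg : List (Edge n) → Fin n → ℕ
  odeg es u = ∑ (allFin n) (opn es u)

  odeg≤n : ∀ es u → odeg es u ≤ n
  odeg≤n es u = ∑-≤1 (opn≤1 es u)

  deg≤ : ∀ es u → ∑[ v ∈ allFin n ] ⟦ adj G u v ⟧ ≤ odeg es u + bdeg es u
  deg≤ es u = ≤-trans (∑-mono (allFin n) (adj≤ es u)) (≤-reflexive (∑-+ (allFin n) _ _))

  paths : List (Edge n) → Fin n → Fin n → ℕ
  paths es u v = ∑[ w ∈ allFin n ] (opn es u w * opn es w v)

  codeg≡ : ∀ u v → codeg G u v ≡ ∑[ w ∈ allFin n ] (⟦ adj G u w ⟧ * ⟦ adj G v w ⟧)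
  codeg≡ u v = trans (length-filter-∑ (λ w → adj G u w ∧ adj G v w) (allFin n))
    (∑-cong (allFin n) (λ w → ⟦∧⟧ (adj G u w) (adj G v w)))

  codeg≤deg : ∀ u v → codeg G u v ≤ ∑[ w ∈ allFin n ] ⟦ adj G u w ⟧
  codeg≤deg u v = ≤-trans (≤-reflexive (codeg≡ u v))
    (∑-mono (allFin n) (λ w → ≤-trans (*-monoʳ-≤ ⟦ adj G u w ⟧ (⟦⟧≤1 (adj G v w))) (≤-reflexive (*-identityʳ _))))

  codeg-diagonal : ∀ u → codeg G u u ≡ ∑[ w ∈ allFin n ] ⟦ adj G u w ⟧
  codeg-diagonal u = trans (codeg≡ u u) (∑-cong (allFin n) (λ w → idem (adj G u w)))
    where
    idem : ∀ b → ⟦ b ⟧ * ⟦ b ⟧ ≡ ⟦ b ⟧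
    idem true  = refl
    idem false = refl

  -- A common neighbour fails to be the middle of an open path only if Breaker holds its edge to `u`
  -- or to `v`, and the acquired degrees count those edges.
  codeg≤paths : ∀ es u v → codeg G u v ≤ paths es u v + (bdeg es u + bdeg es v)
  codeg≤paths es u v = begin
    codeg G u v
      ≡⟨ codeg≡ u v ⟩
    ∑[ w ∈ allFin n ] (⟦ adj G u w ⟧ * ⟦ adj G v w ⟧)
      ≤⟨ ∑-mono (allFin n) pointwise ⟩
    ∑[ w ∈ allFin n ] (opn es u w * opn es w v + (mem es u w + mem es v w))
      ≡⟨ trans (∑-+ (allFin n) _ _) (cong (paths es u v +_) (∑-+ (allFin n) _ _)) ⟩
    paths es u v + (bdeg es u + bdeg es v) ∎
    where
    open ≤-Reasoning
    pointwise : ∀ w → ⟦ adj G u w ⟧ * ⟦ adj G v w ⟧ ≤ opn es u w * opn es w v + (mem es u w + mem es v w)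
    pointwise w rewrite opn-sym es w v with adj G u w | adj G v w | memE es u w | memE es v w
    ... | false | _     | _     | _     = z≤n
    ... | true  | false | _     | _     = z≤n
    ... | true  | true  | false | false = ≤-refl
    ... | true  | true  | true  | _     = s≤s z≤n
    ... | true  | true  | false | true  = s≤s z≤n

  -- Breaker's move changes each degree by at most 2 (in fact by at most 1).
  opn-∷ : ∀ e es u v → opn es u v ≤ hits e u v + opn (e ∷ es) u v
  opn-∷ e@(a , b) es u v with adj G u v
  ... | false = z≤n
  ... | true  = complement (memE (e ∷ es) u v) (memE es u v) (mem-∷ e es u v)
    where
    complement : ∀ p q {h} → ⟦ p ⟧ ≤ h + ⟦ q ⟧ → ⟦ not q ⟧ ≤ h + ⟦ not p ⟧
    complement p     true  _ = z≤n
    complement false false {h} _ = m≤n+m 1 h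
    complement true  false p = p

  opn-∷≤ : ∀ e es u v → opn (e ∷ es) u v ≤ opn es u v
  opn-∷≤ (a , b) es u v with adj G u v | ((a == u) ∧ (b == v)) ∨ ((a == v) ∧ (b == u))
  ... | false | _     = z≤n
  ... | true  | true  = z≤n
  ... | true  | false = ≤-refl

  unvNbrs : List (Edge n) → List (Fin n) → Fin n → ℕ
  unvNbrs es h u = ∑[ x ∈ allFin n ] (opn es u x * unv h x)

  unvNbrs≤#unv : ∀ es h u → unvNbrs es h u ≤ #unv h
  unvNbrs≤#unv es h u = ∑-mono (allFin n) (λ x →
    ≤-trans (*-monoˡ-≤ (unv h x) (opn≤1 es u x)) (≤-reflexive (*-identityˡ _)))

  -- There are no loops, so visiting `w` leaves the unvisited neighbours of `w` unchanged. The gain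
  -- available at `w` can thus be measured before the move to `w`.
  unvNbrs-∷-self : ∀ es h w → unvNbrs es (w ∷ h) w ≡ unvNbrs es h w
  unvNbrs-∷-self es h w = ∑-cong (allFin n) same
    where
    same : ∀ x → opn es w x * unv (w ∷ h) x ≡ opn es w x * unv h x
    same x with w Fin.≟ x
    ... | yes refl rewrite opn-irrefl es w = refl
    ... | no _     = refl

  unvNbrs-acquire : ∀ e es h u → unvNbrs es h u ≤ 2 + unvNbrs (e ∷ es) h u
  unvNbrs-acquire e es h u = begin
    unvNbrs es h u
      ≤⟨ ∑-mono (allFin n) (λ x → *-monoˡ-≤ (unv h x) (opn-∷ e es u x)) ⟩
    ∑[ x ∈ allFin n ] ((hits e u x + opn (e ∷ es) u x) * unv h x)
      ≡⟨ trans (∑-cong (allFin n) (λ x → *-distribʳ-+ (unv h x) (hits e u x) _)) (∑-+ (allFin n) _ _) ⟩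
    ∑[ x ∈ allFin n ] (hits e u x * unv h x) + unvNbrs (e ∷ es) h u
      ≤⟨ +-monoˡ-≤ _ (≤-trans (∑-mono (allFin n) (λ x → ≤-trans (*-monoʳ-≤ (hits e u x) (⟦⟧≤1 _)) (≤-reflexive (*-identityʳ _)))) (∑-hits≤2 e u)) ⟩
    2 + unvNbrs (e ∷ es) h u ∎
    where open ≤-Reasoning

  odeg-acquire : ∀ e es u → odeg es u ≤ 2 + odeg (e ∷ es) u
  odeg-acquire e es u = ≤-trans (∑-mono (allFin n) (opn-∷ e es u))
    (≤-trans (≤-reflexive (∑-+ (allFin n) _ _)) (+-monoˡ-≤ _ (∑-hits≤2 e u)))

bdeg-acquire : ∀ {n} e es (u : Fin n) → bdeg (e ∷ es) u ≤ 2 + bdeg es u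
bdeg-acquire e es u = ≤-trans (bdeg-∷ e es u) (+-monoˡ-≤ _ (∑-hits≤2 e u))

-- The potential and its change in one round

-- `keep` covers a position in which no legal edge is left for Breaker.
data _↝_ {n : ℕ} (es : List (Edge n)) : List (Edge n) → Set where
  keep    : es ↝ es
  acquire : ∀ e → es ↝ (e ∷ es)

module _ {n : ℕ} (G : Graph n) {es es' : List (Edge n)} where

  opn-↝ : es ↝ es' → ∀ u v → opn G es' u v ≤ opn G es u v
  opn-↝ keep        u v = ≤-refl
  opn-↝ (acquire e) u v = opn-∷≤ G e es u v

  unvNbrs-↝ : es ↝ es' → ∀ h u → unvNbrs G es h u ≤ 2 + unvNbrs G es' h u
  unvNbrs-↝ keep        h u = m≤n+m _ 2
  unvNbrs-↝ (acquire e) h u = unvNbrs-acquire G e es h u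

  odeg-↝ : es ↝ es' → ∀ u → odeg G es u ≤ 2 + odeg G es' u
  odeg-↝ keep        u = m≤n+m _ 2
  odeg-↝ (acquire e) u = odeg-acquire G e es u

  bdeg-↝ : es ↝ es' → ∀ u → bdeg es' u ≤ 2 + bdeg es u
  bdeg-↝ keep        u = m≤n+m _ 2
  bdeg-↝ (acquire e) u = bdeg-acquire e es u

  length-↝ : es ↝ es' → length es' ≤ suc (length es)
  length-↝ keep        = n≤1+n _
  length-↝ (acquire e) = ≤-refl

otherVertex : ∀ {n} → 2 ≤ n → (v : Fin n) → ∃ λ x → v ≢ x
otherVertex (s≤s (s≤s _)) zero    = suc zero , λ ()
otherVertex (s≤s (s≤s _)) (suc v) = zero , λ ()

module Potential {n : ℕ} (G : Graph n) where

  V : List (Fin n)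
  V = allFin n

  -- An upper bound for n times the expected number of unvisited vertices after
  -- the walker's next move: she has at most n choices, and the 2 allows for
  -- Breaker's move before that.
  expectedUnv : List (Edge n) → List (Fin n) → Fin n → ℕ
  expectedUnv es h v = n * #unv h ∸ (unvNbrs G es h v ∸ 2)

  module _ (1≤n : 1 ≤ n) where

    -- Makes the outer truncated subtraction in `expectedUnv` exact.
    gain≤ : ∀ es h v → unvNbrs G es h v ∸ 2 ≤ n * #unv h
    gain≤ es h v = ≤-trans (m∸n≤m _ 2) (≤-trans (unvNbrs≤#unv G es h v)
      (≤-trans (≤-reflexive (sym (*-identityˡ _))) (*-monoˡ-≤ (#unv h) 1≤n)))

    expectedUnv-+ : ∀ es h v → expectedUnv es h v + (unvNbrs G es h v ∸ 2) ≡ n * #unv h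
    expectedUnv-+ es h v = m∸n+n≡m (gain≤ es h v)

    -- The unvisited neighbours reached by the move, each with weight `n`, pay for the gain already
    -- subtracted at `v`: the open degree is at most `n`, and Breaker's move destroys at most the 2
    -- that was set aside. The gain available at the new vertex `w` remains as the second sum.
    ∑-expectedUnv : ∀ {es es'} → es ↝ es' → ∀ h v →
      ∑[ w ∈ V ] (opn G es' v w * expectedUnv es' (w ∷ h) w) + ∑[ w ∈ V ] (opn G es' v w * (unvNbrs G es' h w ∸ 2))
        ≤ odeg G es' v * expectedUnv es h v
    ∑-expectedUnv {es} {es'} m h v = +-cancelʳ-≤ (d * (unvNbrs G es h v ∸ 2)) _ _ (begin
      ΣF + Σe + d * (unvNbrs G es h v ∸ 2)
        ≤⟨ +-monoʳ-≤ (ΣF + Σe) (*-mono-≤ (odeg≤n G es' v) (m≤n+o⇒m∸n≤o _ 2 (unvNbrs-↝ G m h v))) ⟩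
      ΣF + Σe + n * unvNbrs G es' h v
        ≡⟨ cong₂ _+_ (sym (∑-+ V _ _)) (sym (∑-*ˡ V n _)) ⟩
      ∑[ w ∈ V ] (o w * expectedUnv es' (w ∷ h) w + o w * (unvNbrs G es' h w ∸ 2)) + ∑[ w ∈ V ] (n * (o w * unv h w))
        ≡⟨ trans (sym (∑-+ V _ _)) (∑-cong V pointwise) ⟩
      ∑[ w ∈ V ] (o w * (n * #unv h))
        ≡⟨ ∑-*ʳ V (n * #unv h) o ⟩
      d * (n * #unv h)
        ≡⟨ trans (cong (d *_) (sym (expectedUnv-+ es h v))) (*-distribˡ-+ d _ _) ⟩
      d * expectedUnv es h v + d * (unvNbrs G es h v ∸ 2) ∎)
      where
      open ≤-Reasoning
      d = odeg G es' v
      o = opn G es' v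
      ΣF = ∑[ w ∈ V ] (o w * expectedUnv es' (w ∷ h) w)
      Σe = ∑[ w ∈ V ] (o w * (unvNbrs G es' h w ∸ 2))
      factor : ∀ o F e n u → o * F + o * e + n * (o * u) ≡ o * (F + e + n * u)
      factor = solve-∀
      pointwise : ∀ w → o w * expectedUnv es' (w ∷ h) w + o w * (unvNbrs G es' h w ∸ 2) + n * (o w * unv h w) ≡ o w * (n * #unv h)
      pointwise w = trans (factor (o w) (expectedUnv es' (w ∷ h) w) (unvNbrs G es' h w ∸ 2) n (unv h w)) (cong (o w *_)
        (trans (cong (_+ n * unv h w)
          (trans (cong (λ e → expectedUnv es' (w ∷ h) w + (e ∸ 2)) (sym (unvNbrs-∷-self G es' h w))) (expectedUnv-+ es' (w ∷ h) w)))
          (trans (sym (*-distribˡ-+ n (#unv (w ∷ h)) (unv h w))) (cong (n *_) (#unv-∷ w h)))))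

    ∑-expectedUnv≤ : ∀ {es es'} → es ↝ es' → ∀ h v →
      ∑[ w ∈ V ] (opn G es' v w * expectedUnv es' (w ∷ h) w) ≤ odeg G es' v * expectedUnv es h v
    ∑-expectedUnv≤ m h v = ≤-trans (m≤m+n _ _) (∑-expectedUnv m h v)

  -- The subtracted gain is at most `u = #unv h`, and `n * u - u` is at least `n` once both factors
  -- are at least 2. This makes the certificate trivial when no rounds are left.
  n≤expectedUnv : ∀ es h v → 2 ≤ n → 2 ≤ #unv h → n ≤ expectedUnv es h v
  n≤expectedUnv es h v 2≤n 2≤u = ≤-trans n≤nu∸u (∸-monoʳ-≤ (n * #unv h) (≤-trans (m∸n≤m (unvNbrs G es h v) 2) (unvNbrs≤#unv G es h v)))
    where
    open ≤-Reasoning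
    u = #unv h
    n≤nu∸u : n ≤ n * u ∸ u
    n≤nu∸u = m+n≤o⇒m≤o∸n n (begin
      n + u
        ≤⟨ lemma 2≤n 2≤u ⟩
      n * u ∎)
      where
      lemma : ∀ {a b} → 2 ≤ a → 2 ≤ b → a + b ≤ a * b
      lemma {suc (suc a)} {suc (suc b)} (s≤s (s≤s _)) (s≤s (s≤s _)) = ≤-trans (m≤m+n _ (a + b + a * b)) (≤-reflexive (expand a b))
        where
        expand : ∀ a b → suc (suc a) + suc (suc b) + (a + b + a * b) ≡ suc (suc a) * suc (suc b)
        expand = solve-∀

  expectedUnv≤ : ∀ es h v → expectedUnv es h v ≤ n * n
  expectedUnv≤ es h v = ≤-trans (m∸n≤m (n * #unv h) (unvNbrs G es h v ∸ 2)) (*-monoʳ-≤ n (#unv≤n h))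

-- Bad vertices and exposure

module Estimates {n : ℕ} (G : Graph n) (A T L D : ℕ) (2≤n : 2 ≤ n)
  (codegree : ∀ u v → u ≢ v → n ≤ A * codeg G u v)
  (bad-count : 8 * A * T ≤ n * L) (D-small : 4 * A * (D + 4) ≤ 2 * n) where

  open Potential G

  1≤n : 1 ≤ n
  1≤n = ≤-trans (s≤s z≤n) 2≤n

  -- On the diagonal the codegree is the degree, which dominates the codegree with any other vertex.
  -- Lower bounds on degrees thus come from the same inequality.
  n≤A*codeg : ∀ u v → n ≤ A * codeg G u v
  n≤A*codeg u v with u Fin.≟ v
  ... | no u≢v   = codegree u v u≢v
  ... | yes refl with otherVertex 2≤n u
  ...   | x , u≢x = ≤-trans (codegree u x u≢x)
    (*-monoʳ-≤ A (≤-trans (codeg≤deg G u x) (≤-reflexive (sym (codeg-diagonal G u)))))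

  bad : List (Edge n) → Fin n → ℕ
  bad es v = ⟦ not ⌊ 4 * A * bdeg es v ≤? n ⌋ ⟧

  -- Breaker's next move can turn any of these into a vertex of small open degree.
  sparse : List (Edge n) → Fin n → ℕ
  sparse es v = ⟦ ⌊ odeg G es v ≤? D + 4 ⌋ ⟧

  -- Outside this set the walker keeps more than `D` open edges after Breaker's next move.
  trap : List (Edge n) → Fin n → ℕ
  trap es v = ⟦ ⌊ odeg G es v ≤? D + 2 ⌋ ⟧

  private
    split : ∀ A p b → 4 * (A * (p + b)) ≡ 4 * A * p + 4 * A * b
    split = solve-∀

    double : ∀ A d → 4 * A * d ≡ 2 * (2 * A * d)
    double = solve-∀

  -- Double counting: acquired degrees sum to at most `2 * T`, and each bad vertex takes more than
  -- `n / 4A` of this.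
  #bad≤L : ∀ es → length es ≤ T → ∑ V (bad es) ≤ L
  #bad≤L es es≤T = *-cancelˡ-≤ n {{>-nonZero 1≤n}} (begin
    n * ∑ V (bad es)
      ≡⟨ sym (∑-*ˡ V n _) ⟩
    ∑[ v ∈ V ] (n * bad es v)
      ≤⟨ ∑-mono V pointwise ⟩
    ∑[ v ∈ V ] (4 * A * bdeg es v)
      ≡⟨ ∑-*ˡ V (4 * A) _ ⟩
    4 * A * ∑ V (bdeg es)
      ≤⟨ *-monoʳ-≤ (4 * A) (≤-trans (∑-bdeg es) (*-monoʳ-≤ 2 es≤T)) ⟩
    4 * A * (2 * T)
      ≡⟨ regroup A T ⟩
    8 * A * T
      ≤⟨ bad-count ⟩
    n * L ∎)
    where
    open ≤-Reasoning
    regroup : ∀ A T → 4 * A * (2 * T) ≡ 8 * A * T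
    regroup = solve-∀
    pointwise : ∀ v → n * bad es v ≤ 4 * A * bdeg es v
    pointwise v with 4 * A * bdeg es v ≤? n
    ... | yes _ = ≤-trans (≤-reflexive (*-zeroʳ n)) z≤n
    ... | no ¬p = ≤-trans (≤-reflexive (*-identityʳ n)) (<⇒≤ (≰⇒> ¬p))

  n≤A*degree : ∀ es v → n ≤ A * (odeg G es v + bdeg es v)
  n≤A*degree es v = ≤-trans (n≤A*codeg v v) (*-monoʳ-≤ A
    (≤-trans (codeg≤deg G v v) (deg≤ G es v)))

  -- The degree is at least `n / A` and Breaker holds at most `n / 2A` of it. The bound `2 * n`
  -- instead of `n` leaves room for the Breaker move made at a good vertex.
  odeg-large : ∀ es v → 4 * A * bdeg es v ≤ 2 * n → n ≤ 2 * A * odeg G es v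
  odeg-large es v b = *-cancelˡ-≤ 2 (+-cancelʳ-≤ (2 * n) _ _ (begin
    2 * n + 2 * n
      ≡⟨ four n ⟩
    4 * n
      ≤⟨ *-monoʳ-≤ 4 (n≤A*degree es v) ⟩
    4 * (A * (odeg G es v + bdeg es v))
      ≡⟨ trans (split A _ _) (cong (_+ 4 * A * bdeg es v) (double A (odeg G es v))) ⟩
    2 * (2 * A * odeg G es v) + 4 * A * bdeg es v
      ≤⟨ +-monoʳ-≤ _ b ⟩
    2 * (2 * A * odeg G es v) + 2 * n ∎))
    where
    open ≤-Reasoning
    four : ∀ n → 2 * n + 2 * n ≡ 4 * n
    four = solve-∀

  -- A sparse good vertex would have degree at most `n / 2A + n / 4A`, less than `n / A`.
  sparse≤bad : ∀ es v → sparse es v ≤ bad es v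
  sparse≤bad es v with odeg G es v ≤? D + 4 | 4 * A * bdeg es v ≤? n
  ... | no _  | _     = z≤n
  ... | yes _ | no _  = ≤-refl
  ... | yes p | yes q = contradiction (begin
    4 * n
      ≤⟨ *-monoʳ-≤ 4 (n≤A*degree es v) ⟩
    4 * (A * (odeg G es v + bdeg es v))
      ≡⟨ split A _ _ ⟩
    4 * A * odeg G es v + 4 * A * bdeg es v
      ≤⟨ +-mono-≤ (≤-trans (*-monoʳ-≤ (4 * A) p) D-small) q ⟩
    2 * n + n
      ≡⟨ three n ⟩
    3 * n ∎) (<⇒≱ (*-monoˡ-< n {{>-nonZero 1≤n}} (n<1+n 3)))
    where
    open ≤-Reasoning
    three : ∀ n → 2 * n + n ≡ 3 * n
    three = solve-∀

  -- Of at least `n / A` common neighbours, Breaker spoils at most `n / 2A` at `u` and `n / 4A` at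
  -- `v`.
  paths-large : ∀ es u v → 4 * A * bdeg es u ≤ 2 * n → 4 * A * bdeg es v ≤ n →
    n ≤ 4 * A * paths G es u v
  paths-large es u v bu bv = +-cancelʳ-≤ (2 * n + n) _ _ (begin
    n + (2 * n + n)
      ≡⟨ four n ⟩
    4 * n
      ≤⟨ *-monoʳ-≤ 4 (≤-trans (n≤A*codeg u v) (*-monoʳ-≤ A (codeg≤paths G es u v))) ⟩
    4 * (A * (paths G es u v + (bdeg es u + bdeg es v)))
      ≡⟨ split₃ A _ _ _ ⟩
    4 * A * paths G es u v + (4 * A * bdeg es u + 4 * A * bdeg es v)
      ≤⟨ +-monoʳ-≤ (4 * A * paths G es u v) (+-mono-≤ bu bv) ⟩
    4 * A * paths G es u v + (2 * n + n) ∎)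
    where
    open ≤-Reasoning
    four : ∀ n → n + (2 * n + n) ≡ 4 * n
    four = solve-∀
    split₃ : ∀ A p b c → 4 * (A * (p + (b + c))) ≡ 4 * A * p + (4 * A * b + 4 * A * c)
    split₃ = solve-∀

  -- Decay of the potential at a good vertex

  module _ (h : List (Fin n)) (2L≤u : 2 * L ≤ #unv h) (32A≤u : 32 * A ≤ #unv h) where

    -- The sum counts open two-step walks from `v` to unvisited vertices. At most `L` of these
    -- vertices, hence at most half, are bad, and each of the others is the end of at least `n / 4A`
    -- walks.
    ∑-unvNbrs : ∀ es v → length es ≤ T → 4 * A * bdeg es v ≤ 2 * n →
      n * #unv h ≤ 8 * A * ∑[ w ∈ V ] (opn G es v w * unvNbrs G es h w)
    ∑-unvNbrs es v es≤T b = +-cancelʳ-≤ (n * #unv h) _ _ (begin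
      n * #unv h + n * #unv h
        ≡⟨ dbl (n * #unv h) ⟩
      2 * (n * #unv h)
        ≤⟨ *-monoʳ-≤ 2 (begin
          n * #unv h
            ≡⟨ sym (∑-*ˡ V n _) ⟩
          ∑[ x ∈ V ] (n * unv h x)
            ≤⟨ ∑-mono V pointwise ⟩
          ∑[ x ∈ V ] (4 * A * (unv h x * paths G es v x) + n * bad es x)
            ≡⟨ trans (∑-+ V _ _) (cong₂ _+_ (∑-*ˡ V (4 * A) _) (∑-*ˡ V n _)) ⟩
          4 * A * ∑[ x ∈ V ] (unv h x * paths G es v x) + n * ∑ V (bad es)
            ≤⟨ +-mono-≤ (≤-reflexive (cong (4 * A *_) exchange)) (*-monoʳ-≤ n (#bad≤L es es≤T)) ⟩
          4 * A * S + n * L ∎) ⟩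
      2 * (4 * A * S + n * L)
        ≡⟨ regroup A S n L ⟩
      8 * A * S + n * (2 * L)
        ≤⟨ +-monoʳ-≤ (8 * A * S) (*-monoʳ-≤ n 2L≤u) ⟩
      8 * A * S + n * #unv h ∎)
      where
      open ≤-Reasoning
      S = ∑[ w ∈ V ] (opn G es v w * unvNbrs G es h w)
      dbl : ∀ m → m + m ≡ 2 * m
      dbl = solve-∀
      regroup : ∀ A S n L → 2 * (4 * A * S + n * L) ≡ 8 * A * S + n * (2 * L)
      regroup = solve-∀
      pointwise : ∀ x → n * unv h x ≤ 4 * A * (unv h x * paths G es v x) + n * bad es x
      pointwise x with any (_== x) h | 4 * A * bdeg es x ≤? n
      ... | true  | _     = ≤-trans (≤-reflexive (*-zeroʳ n)) z≤n
      ... | false | no _  = m≤n+m _ _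
      ... | false | yes p = ≤-trans (≤-trans (≤-reflexive (*-identityʳ n)) (paths-large es v x b p))
        (≤-trans (≤-reflexive (cong (4 * A *_) (sym (*-identityˡ _)))) (m≤m+n _ _))
      rotate : ∀ a b c → a * (b * c) ≡ b * (c * a)
      rotate = solve-∀
      exchange : ∑[ x ∈ V ] (unv h x * paths G es v x) ≡ S
      exchange = begin-equality
        ∑[ x ∈ V ] (unv h x * paths G es v x)
          ≡⟨ ∑-cong V (λ x → trans (sym (∑-*ˡ V (unv h x) _)) (∑-cong V (λ w → rotate (unv h x) (opn G es v w) (opn G es w x)))) ⟩
        ∑[ x ∈ V ] ∑[ w ∈ V ] (opn G es v w * (opn G es w x * unv h x))
          ≡⟨ ∑-swap V V _ ⟩
        ∑[ w ∈ V ] ∑[ x ∈ V ] (opn G es v w * (opn G es w x * unv h x))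
          ≡⟨ ∑-cong V (λ w → ∑-*ˡ V (opn G es v w) _) ⟩
        S ∎

    -- Subtracting 2 at each of at most `n` neighbours costs at most half of the previous bound,
    -- because `32 * A` is at most the number of unvisited vertices.
    ∑-gain : ∀ es v → length es ≤ T → 4 * A * bdeg es v ≤ 2 * n →
      n * #unv h ≤ 16 * A * ∑[ w ∈ V ] (opn G es v w * (unvNbrs G es h w ∸ 2))
    ∑-gain es v es≤T b = +-cancelʳ-≤ (n * #unv h) _ _ (begin
      n * #unv h + n * #unv h
        ≡⟨ dbl (n * #unv h) ⟩
      2 * (n * #unv h)
        ≤⟨ *-monoʳ-≤ 2 (∑-unvNbrs es v es≤T b) ⟩
      2 * (8 * A * ∑[ w ∈ V ] (opn G es v w * unvNbrs G es h w))
        ≤⟨ *-monoʳ-≤ 2 (*-monoʳ-≤ (8 * A) (begin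
          ∑[ w ∈ V ] (opn G es v w * unvNbrs G es h w)
            ≤⟨ ∑-mono V (λ w → *-monoʳ-≤ (opn G es v w) (m≤n+m∸n (unvNbrs G es h w) 2)) ⟩
          ∑[ w ∈ V ] (opn G es v w * (2 + (unvNbrs G es h w ∸ 2)))
            ≡⟨ trans (∑-cong V (λ w → *-distribˡ-+ (opn G es v w) 2 _)) (∑-+ V _ _) ⟩
          ∑[ w ∈ V ] (opn G es v w * 2) + S
            ≡⟨ cong (_+ S) (∑-*ʳ V 2 _) ⟩
          odeg G es v * 2 + S ∎)) ⟩
      2 * (8 * A * (odeg G es v * 2 + S))
        ≡⟨ regroup A (odeg G es v) S ⟩
      16 * A * S + odeg G es v * (32 * A)
        ≤⟨ +-monoʳ-≤ (16 * A * S) (*-mono-≤ (odeg≤n G es v) 32A≤u) ⟩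
      16 * A * S + n * #unv h ∎)
      where
      open ≤-Reasoning
      S = ∑[ w ∈ V ] (opn G es v w * (unvNbrs G es h w ∸ 2))
      dbl : ∀ m → m + m ≡ 2 * m
      dbl = solve-∀
      regroup : ∀ A d S → 2 * (8 * A * (d * 2 + S)) ≡ 16 * A * S + d * (32 * A)
      regroup = solve-∀

    -- The sum of gains left over by `∑-expectedUnv` is at least the fraction `1 / (16 * A * n)` of
    -- `d * F`, since `d` is at most `n` and `F` at most `n * #unv h`.
    ∑-expectedUnv-good : ∀ {es es'} → es ↝ es' → ∀ v → length es' ≤ T → 4 * A * bdeg es' v ≤ 2 * n →
      16 * A * n * ∑[ w ∈ V ] (opn G es' v w * expectedUnv es' (w ∷ h) w) + odeg G es' v * expectedUnv es h v
        ≤ 16 * A * n * (odeg G es' v * expectedUnv es h v)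
    ∑-expectedUnv-good {es} {es'} m v es≤T b = begin
      16 * A * n * ΣF + d * F
        ≤⟨ +-monoʳ-≤ (16 * A * n * ΣF) (*-mono-≤ (odeg≤n G es' v) (≤-trans (m∸n≤m (n * #unv h) (unvNbrs G es h v ∸ 2)) (∑-gain es' v es≤T b))) ⟩
      16 * A * n * ΣF + n * (16 * A * Σe)
        ≡⟨ regroup A n ΣF Σe ⟩
      16 * A * n * (ΣF + Σe)
        ≤⟨ *-monoʳ-≤ (16 * A * n) (∑-expectedUnv 1≤n m h v) ⟩
      16 * A * n * (d * F) ∎
      where
      open ≤-Reasoning
      d = odeg G es' v
      F = expectedUnv es h v
      ΣF = ∑[ w ∈ V ] (opn G es' v w * expectedUnv es' (w ∷ h) w)
      Σe = ∑[ w ∈ V ] (opn G es' v w * (unvNbrs G es' h w ∸ 2))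
      regroup : ∀ A n F e → 16 * A * n * F + n * (16 * A * e) ≡ 16 * A * n * (F + e)
      regroup = solve-∀

  -- Bounds the number of traps among the walker's choices after Breaker's next move.
  exposure : List (Edge n) → Fin n → ℕ
  exposure es v = ∑[ z ∈ V ] (opn G es v z * sparse es z)

  opn*≤ : ∀ es u v m → opn G es u v * m ≤ m
  opn*≤ es u v m = ≤-trans (*-monoˡ-≤ m (opn≤1 G es u v)) (≤-reflexive (*-identityˡ m))

  ∑-bad : ∀ es v → length es ≤ T → ∑[ w ∈ V ] (opn G es v w * bad es w) ≤ L
  ∑-bad es v es≤T = ≤-trans (∑-mono V (λ w → opn*≤ es v w (bad es w))) (#bad≤L es es≤T)

  exposure≤L : ∀ es v → length es ≤ T → exposure es v ≤ L
  exposure≤L es v es≤T = ≤-trans (∑-mono V (λ z → *-monoʳ-≤ (opn G es v z) (sparse≤bad es z))) (∑-bad es v es≤T)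

  -- One Breaker move lowers an open degree by at most 2 and opens no edge, so a trap after the move
  -- was a sparse open neighbour before it.
  ∑-trap : ∀ {es es'} → es ↝ es' → ∀ v → ∑[ w ∈ V ] (opn G es' v w * trap es' w) ≤ exposure es v
  ∑-trap {es} {es'} m v = ∑-mono V (λ w → *-mono-≤ (opn-↝ G m v w) (pointwise w))
    where
    pointwise : ∀ w → trap es' w ≤ sparse es w
    pointwise w with odeg G es' w ≤? D + 2 | odeg G es w ≤? D + 4
    ... | no _  | _     = z≤n
    ... | yes _ | yes _ = ≤-refl
    ... | yes p | no ¬q = contradiction
      (≤-trans (odeg-↝ G m w) (≤-trans (+-monoʳ-≤ 2 p) (≤-reflexive (shift D)))) ¬q
      where
      shift : ∀ D → 2 + (D + 2) ≡ D + 4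
      shift = solve-∀

  -- After exchanging the sums, each sparse vertex is counted once per open edge: at most `L`
  -- vertices with at most `D + 4` edges each. The bound does not grow with the open degree of `v`.
  ∑-exposure : ∀ es v → length es ≤ T → ∑[ w ∈ V ] (opn G es v w * exposure es w) ≤ L * (D + 4)
  ∑-exposure es v es≤T = begin
    ∑[ w ∈ V ] (opn G es v w * exposure es w)
      ≤⟨ ∑-mono V (λ w → opn*≤ es v w (exposure es w)) ⟩
    ∑[ w ∈ V ] exposure es w
      ≡⟨ ∑-swap V V _ ⟩
    ∑[ z ∈ V ] ∑[ w ∈ V ] (opn G es w z * sparse es z)
      ≡⟨ ∑-cong V (λ z → trans (∑-*ʳ V (sparse es z) _) (cong (_* sparse es z) (∑-cong V (λ w → opn-sym G es w z)))) ⟩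
    ∑[ z ∈ V ] (odeg G es z * sparse es z)
      ≤⟨ ∑-mono V pointwise ⟩
    ∑[ z ∈ V ] (bad es z * (D + 4))
      ≡⟨ ∑-*ʳ V (D + 4) _ ⟩
    ∑ V (bad es) * (D + 4)
      ≤⟨ *-monoˡ-≤ (D + 4) (#bad≤L es es≤T) ⟩
    L * (D + 4) ∎
    where
    open ≤-Reasoning
    low : ∀ z → odeg G es z * sparse es z ≤ sparse es z * (D + 4)
    low z with odeg G es z ≤? D + 4
    ... | yes p = ≤-trans (≤-reflexive (*-identityʳ _)) (≤-trans p (≤-reflexive (sym (*-identityˡ (D + 4)))))
    ... | no _  = ≤-reflexive (*-zeroʳ (odeg G es z))
    pointwise : ∀ z → odeg G es z * sparse es z ≤ bad es z * (D + 4)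
    pointwise z = ≤-trans (low z) (*-monoˡ-≤ (D + 4) (sparse≤bad es z))

-- The game is not over

any-allFin : ∀ {n} (p : Fin n → Bool) u → p u ≡ true → any p (allFin n) ≡ true
any-allFin p u pu = Equivalence.to T-≡ (any⁺ p (lose (∈-allFin u) (Equivalence.from T-≡ pu)))

positive-factors : ∀ a b → 1 ≤ a * b → 1 ≤ a × 1 ≤ b
positive-factors (suc a) (suc b) _ = s≤s z≤n , s≤s z≤n
positive-factors (suc a) zero    p = contradiction (≤-trans p (≤-reflexive (*-zeroʳ a))) λ ()

module _ {n : ℕ} (G : Graph n) (s : State n) where

  reachK-suc : ∀ k {v} → reachK G k s v ≡ true → reachK G (suc k) s v ≡ true
  reachK-suc k r rewrite r = refl

  reachK-step : ∀ k {u v} → reachK G k s u ≡ true → openE G s u v ≡ true → reachK G (suc k) s v ≡ true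
  reachK-step k {u} {v} r o = trans
    (cong (reachK G k s v ∨_) (any-allFin (λ u → reachK G k s u ∧ openE G s u v) u (cong₂ _∧_ r o)))
    (∨-zeroʳ _)

  reachK-mono : ∀ {k l v} → k ≤ l → reachK G k s v ≡ true → reachK G l s v ≡ true
  reachK-mono {k} {v = v} k≤l r = go (≤⇒≤′ k≤l)
    where
    go : ∀ {l} → k ≤′ l → reachK G l s v ≡ true
    go ≤′-refl           = r
    go (≤′-step {l} k≤l) = reachK-suc l (go k≤l)

  reachK-pos : reachK G 0 s (pos s) ≡ true
  reachK-pos with pos s Fin.≟ pos s
  ... | yes _ = refl
  ... | no ¬p = contradiction refl ¬p

  not-over : ∀ v → reachable G s v ≡ true → visited G s v ≡ false → over G s ≡ false
  not-over v r u = cong not (any-allFin (λ v → reachable G s v ∧ not (visited G s v)) v (cong₂ (λ a b → a ∧ not b) r u))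

-- Reaching an unvisited vertex

module Endgame {n : ℕ} (G : Graph n) (A T L D : ℕ) (3≤n : 3 ≤ n)
  (codegree : ∀ u v → u ≢ v → n ≤ A * codeg G u v)
  (bad-count : 8 * A * T ≤ n * L) (D-small : 4 * A * (D + 4) ≤ 2 * n) where

  open Potential G
  open Estimates G A T L D (≤-trans (n≤1+n 2) 3≤n) codegree bad-count D-small

  -- Pigeonhole: the at most `L` bad vertices cannot exhaust the set given by `p`.
  good-exists : ∀ es → length es ≤ T → ∀ (p : Fin n → Bool) → L < ∑[ x ∈ V ] ⟦ p x ⟧ →
    ∃ λ x → p x ≡ true × 4 * A * bdeg es x ≤ n
  good-exists es es≤T p L<Σ = extract (∑-positive V (+-cancelʳ-≤ L 1 _ (begin
    suc L
      ≤⟨ L<Σ ⟩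
    ∑[ x ∈ V ] ⟦ p x ⟧
      ≤⟨ ∑-mono V pointwise ⟩
    ∑[ x ∈ V ] (⟦ p x ∧ ⌊ 4 * A * bdeg es x ≤? n ⌋ ⟧ + bad es x)
      ≡⟨ ∑-+ V _ _ ⟩
    ∑[ x ∈ V ] ⟦ p x ∧ ⌊ 4 * A * bdeg es x ≤? n ⌋ ⟧ + ∑ V (bad es)
      ≤⟨ +-monoʳ-≤ (∑[ x ∈ V ] ⟦ p x ∧ ⌊ 4 * A * bdeg es x ≤? n ⌋ ⟧) (#bad≤L es es≤T) ⟩
    ∑[ x ∈ V ] ⟦ p x ∧ ⌊ 4 * A * bdeg es x ≤? n ⌋ ⟧ + L ∎)))
    where
    open ≤-Reasoning
    pointwise : ∀ x → ⟦ p x ⟧ ≤ ⟦ p x ∧ ⌊ 4 * A * bdeg es x ≤? n ⌋ ⟧ + bad es x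
    pointwise x with p x | 4 * A * bdeg es x ≤? n
    ... | false | _     = z≤n
    ... | true  | yes _ = ≤-refl
    ... | true  | no _  = ≤-refl
    extract : (∃ λ x → 1 ≤ ⟦ p x ∧ ⌊ 4 * A * bdeg es x ≤? n ⌋ ⟧) → ∃ λ x → p x ≡ true × 4 * A * bdeg es x ≤ n
    extract (x , q) with p x in px | 4 * A * bdeg es x ≤? n
    ... | true | yes b = x , px , b

  -- Under the first alternative open paths of length two lead to every good vertex; under the
  -- second some open neighbour is good, and such paths start there.
  Mobile : List (Edge n) → Fin n → Set
  Mobile es v = 4 * A * bdeg es v ≤ 2 * n ⊎ L < odeg G es v

  path-exists : ∀ s u x → 4 * A * bdeg (acq s) u ≤ 2 * n → 4 * A * bdeg (acq s) x ≤ n →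
    ∃ λ w → openE G s u w ≡ true × openE G s w x ≡ true
  path-exists s u x bu bx with paths G (acq s) u x in eq | paths-large (acq s) u x bu bx
  ... | zero  | p = contradiction (≤-trans 1≤n (≤-trans p (≤-reflexive (*-zeroʳ (4 * A))))) λ ()
  ... | suc _ | _ with ∑-positive V {λ w → opn G (acq s) u w * opn G (acq s) w x} (≤-trans (s≤s z≤n) (≤-reflexive (sym eq)))
  ...   | w , q with positive-factors (opn G (acq s) u w) (opn G (acq s) w x) q
  ...     | uw , wx = w , ⟦⟧-positive uw , ⟦⟧-positive wx

  mobile⇒not-over : ∀ s → length (acq s) ≤ T → L < #unv (hist s) → Mobile (acq s) (pos s) → over G s ≡ false
  mobile⇒not-over s es≤T L<u mob = conclude (good-exists (acq s) es≤T (λ x → not (visited G s x)) L<u)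
    where
    not-true : ∀ {b} → not b ≡ true → b ≡ false
    not-true {false} _ = refl

    two-steps : ∀ k {u x} → reachK G k s u ≡ true →
      (∃ λ w → openE G s u w ≡ true × openE G s w x ≡ true) → reachK G (2 + k) s x ≡ true
    two-steps k r (w , uw , wx) = reachK-step G s (suc k) (reachK-step G s k r uw) wx

    reach : ∀ x → 4 * A * bdeg (acq s) x ≤ n → Mobile (acq s) (pos s) → reachK G 3 s x ≡ true
    reach x bx (inj₁ b)   = reachK-suc G s 2 (two-steps 0 (reachK-pos G s) (path-exists s (pos s) x b bx))
    reach x bx (inj₂ L<d) = via (good-exists (acq s) es≤T (openE G s (pos s)) L<d)
      where
      via : (∃ λ w → openE G s (pos s) w ≡ true × 4 * A * bdeg (acq s) w ≤ n) → reachK G 3 s x ≡ true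
      via (w , o , b) = two-steps 1 (reachK-step G s 0 (reachK-pos G s) o) (path-exists s w x (≤-trans b (m≤n*m n 2)) bx)

    conclude : (∃ λ x → not (visited G s x) ≡ true × 4 * A * bdeg (acq s) x ≤ n) → over G s ≡ false
    -- At most three steps are used, while `reachable` allows `n` of them; this is where `3 ≤ n`
    -- enters.
    conclude (x , unvisited , bx) = not-over G s x (reachK-mono G s 3≤n (reach x bx mob)) (not-true unvisited)

-- Rational averages and the game recursion

open import Data.Integer using (+_)

ℚ-ring : AlmostCommutativeRing _ _
ℚ-ring = fromCommutativeRing ℚₚ.+-*-commutativeRing (λ p → dec⇒maybe (0ℚ ℚₚ.≟ p))

toℚᵘ-/ : ∀ m d → ℚ.toℚᵘ (+ m / suc d) ℚᵘ.≃ mkℚᵘ (+ m) d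
toℚᵘ-/ m d = ℚₚ.toℚᵘ-fromℚᵘ (mkℚᵘ (+ m) d)

abstract

  -- Kept abstract so that later arguments use only the algebraic and order laws of this embedding
  -- and never compute with normalised fractions.
  ι : ℕ → ℚ
  ι m = + m / 1

  ι≡/ : ∀ m → ι m ≡ + m / 1
  ι≡/ m = refl

  ι-0 : ι 0 ≡ 0ℚ
  ι-0 = refl

  ι-1 : ι 1 ≡ 1ℚ
  ι-1 = refl

  ι-+ : ∀ a b → ι (a + b) ≡ ι a ℚ.+ ι b
  ι-+ a b = ℚₚ.toℚᵘ-injective (ℚᵘₚ.≃-trans (toℚᵘ-/ (a + b) 0) (ℚᵘₚ.≃-trans
    (*≡* (cong (ℤ._* + 1) (sym (cong₂ ℤ._+_ (ℤₚ.*-identityʳ (+ a)) (ℤₚ.*-identityʳ (+ b))))))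
    (ℚᵘₚ.≃-sym (ℚᵘₚ.≃-trans (ℚₚ.toℚᵘ-homo-+ (ι a) (ι b)) (ℚᵘₚ.+-cong (toℚᵘ-/ a 0) (toℚᵘ-/ b 0))))))

  ι-* : ∀ a b → ι (a * b) ≡ ι a ℚ.* ι b
  ι-* a b = ℚₚ.toℚᵘ-injective (ℚᵘₚ.≃-trans (toℚᵘ-/ (a * b) 0) (ℚᵘₚ.≃-trans
    (*≡* (cong (ℤ._* + 1) (ℤₚ.pos-* a b)))
    (ℚᵘₚ.≃-sym (ℚᵘₚ.≃-trans (ℚₚ.toℚᵘ-homo-* (ι a) (ι b)) (ℚᵘₚ.*-cong (toℚᵘ-/ a 0) (toℚᵘ-/ b 0))))))

  ι-mono : ∀ {a b} → a ≤ b → ι a ℚ.≤ ι b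
  ι-mono {a} {b} a≤b = ℚₚ.toℚᵘ-cancel-≤ (ℚᵘₚ.≤-respˡ-≃ (ℚᵘₚ.≃-sym (toℚᵘ-/ a 0)) (ℚᵘₚ.≤-respʳ-≃ (ℚᵘₚ.≃-sym (toℚᵘ-/ b 0))
    (*≤* (ℤₚ.*-monoʳ-≤-nonNeg (+ 1) (ℤ.+≤+ a≤b)))))

  ι-cancel-≤ : ∀ {a b} → ι a ℚ.≤ ι b → a ≤ b
  ι-cancel-≤ {a} {b} p with ℚᵘₚ.≤-respˡ-≃ (toℚᵘ-/ a 0) (ℚᵘₚ.≤-respʳ-≃ (toℚᵘ-/ b 0) (ℚₚ.toℚᵘ-mono-≤ p))
  ... | *≤* q = ℤₚ.drop‿+≤+ (ℤₚ.*-cancelʳ-≤-pos (+ a) (+ b) (+ 1) q)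

  ι-inverse : ∀ d → ι (suc d) ℚ.* (+ 1 / suc d) ≡ 1ℚ
  ι-inverse d = ℚₚ.toℚᵘ-injective (ℚᵘₚ.≃-trans (ℚₚ.toℚᵘ-homo-* (ι (suc d)) (+ 1 / suc d))
    (ℚᵘₚ.≃-trans (ℚᵘₚ.*-cong (toℚᵘ-/ (suc d) 0) (toℚᵘ-/ 1 d)) (*≡* (units (+ suc d)))))
    where
    units : ∀ i → i ℤ.* + 1 ℤ.* + 1 ≡ + 1 ℤ.* (+ 1 ℤ.* i)
    units i = trans (ℤₚ.*-identityʳ _) (trans (ℤₚ.*-identityʳ i) (sym (trans (ℤₚ.*-identityˡ _) (ℤₚ.*-identityˡ i))))

  -- The denominator of `α` serves as `A`, since the numerator is at least 1.
  archimedean : ∀ α → 0ℚ ℚ.< α → ∃ λ A → 1 ≤ A × 1ℚ ℚ.≤ ι A ℚ.* α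
  archimedean α@(mkℚ (+ suc p) d _) _ = suc d , s≤s z≤n , ℚₚ.toℚᵘ-cancel-≤
    (ℚᵘₚ.≤-respʳ-≃ (ℚᵘₚ.≃-sym (ℚᵘₚ.≃-trans (ℚₚ.toℚᵘ-homo-* (ι (suc d)) α) (ℚᵘₚ.*-cong {ℚ.toℚᵘ (ι (suc d))} {mkℚᵘ (+ suc d) 0} {ℚ.toℚᵘ α} (toℚᵘ-/ (suc d) 0) ℚᵘₚ.≃-refl)))
    (*≤* (ℤ.+≤+ (≤-trans (≤-reflexive (left d)) (≤-trans (m≤m*n (suc d) (suc p)) (≤-reflexive (sym (*-identityʳ _))))))))
    where
    left : ∀ d → 1 * suc (d + 0) ≡ suc d
    left = solve-∀
  archimedean (mkℚ (+ 0) _ _)     (ℚ.*<* (ℤ.+<+ ()))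
  archimedean (mkℚ ℤ.-[1+ _ ] _ _) (ℚ.*<* ())

0≤ι : ∀ a → 0ℚ ℚ.≤ ι a
0≤ι a = subst (ℚ._≤ ι a) ι-0 (ι-mono {0} {a} z≤n)

*-monoˡ : ∀ {r p q} → 0ℚ ℚ.≤ r → p ℚ.≤ q → r ℚ.* p ℚ.≤ r ℚ.* q
*-monoˡ {r} 0≤r p≤q = ℚₚ.*-monoˡ-≤-nonNeg r {{ℚ.nonNegative 0≤r}} p≤q

*-monoʳ : ∀ {r p q} → 0ℚ ℚ.≤ r → p ℚ.≤ q → p ℚ.* r ℚ.≤ q ℚ.* r
*-monoʳ {r} 0≤r p≤q = ℚₚ.*-monoʳ-≤-nonNeg r {{ℚ.nonNegative 0≤r}} p≤q

0≤* : ∀ {p q} → 0ℚ ℚ.≤ p → 0ℚ ℚ.≤ q → 0ℚ ℚ.≤ p ℚ.* q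
0≤* {p} {q} 0≤p 0≤q = ℚₚ.≤-trans (ℚₚ.≤-reflexive (sym (ℚₚ.*-zeroʳ p))) (*-monoˡ 0≤p 0≤q)

0≤+ : ∀ {p q} → 0ℚ ℚ.≤ p → 0ℚ ℚ.≤ q → 0ℚ ℚ.≤ p ℚ.+ q
0≤+ 0≤p 0≤q = ℚₚ.+-mono-≤ 0≤p 0≤q

p≤p+q : ∀ {p q} → 0ℚ ℚ.≤ q → p ℚ.≤ p ℚ.+ q
p≤p+q {p} 0≤q = ℚₚ.≤-trans (ℚₚ.≤-reflexive (sym (ℚₚ.+-identityʳ p))) (ℚₚ.+-monoʳ-≤ p 0≤q)

p≤q+p : ∀ {p q} → 0ℚ ℚ.≤ q → p ℚ.≤ q ℚ.+ p
p≤q+p {p} 0≤q = ℚₚ.≤-trans (ℚₚ.≤-reflexive (sym (ℚₚ.+-identityˡ p))) (ℚₚ.+-monoˡ-≤ p 0≤q)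

*-cancelˡ : ∀ {m p q} → 1 ≤ m → ι m ℚ.* p ℚ.≤ ι m ℚ.* q → p ℚ.≤ q
*-cancelˡ {suc d} {p} {q} (s≤s _) le = begin
  p                       ≡⟨ unit p ⟩
  r ℚ.* (ι (suc d) ℚ.* p) ≤⟨ *-monoˡ 0≤r le ⟩
  r ℚ.* (ι (suc d) ℚ.* q) ≡⟨ sym (unit q) ⟩
  q                       ∎
  where
  open ℚₚ.≤-Reasoning
  r = + 1 / suc d
  0≤r : 0ℚ ℚ.≤ r
  0≤r = ℚₚ.nonNegative⁻¹ r {{ℚₚ.normalize-nonNeg 1 (suc d)}}
  unit : ∀ p → p ≡ r ℚ.* (ι (suc d) ℚ.* p)
  unit p = sym (trans (sym (ℚₚ.*-assoc r (ι (suc d)) p)) (trans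
    (cong (ℚ._* p) (trans (ℚₚ.*-comm r (ι (suc d))) (ι-inverse d))) (ℚₚ.*-identityˡ p)))

∑ℚ : ∀ {A : Set} → List A → (A → ℚ) → ℚ
∑ℚ xs f = foldr ℚ._+_ 0ℚ (map f xs)

module _ {A : Set} where

  ∑ℚ-mono : ∀ (xs : List A) {f g} → (∀ x → f x ℚ.≤ g x) → ∑ℚ xs f ℚ.≤ ∑ℚ xs g
  ∑ℚ-mono []       f≤g = ℚₚ.≤-refl
  ∑ℚ-mono (x ∷ xs) f≤g = ℚₚ.+-mono-≤ (f≤g x) (∑ℚ-mono xs f≤g)

  ∑ℚ-+ : ∀ (xs : List A) f g → ∑ℚ xs (λ x → f x ℚ.+ g x) ≡ ∑ℚ xs f ℚ.+ ∑ℚ xs g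
  ∑ℚ-+ []       f g = refl
  ∑ℚ-+ (x ∷ xs) f g = trans (cong (f x ℚ.+ g x ℚ.+_) (∑ℚ-+ xs f g)) (interchange (f x) (g x) (∑ℚ xs f) (∑ℚ xs g))
    where
    interchange : ∀ a b c d → a ℚ.+ b ℚ.+ (c ℚ.+ d) ≡ a ℚ.+ c ℚ.+ (b ℚ.+ d)
    interchange = Solver.solve-∀ ℚ-ring

  ∑ℚ-*ˡ : ∀ (xs : List A) c f → ∑ℚ xs (λ x → c ℚ.* f x) ≡ c ℚ.* ∑ℚ xs f
  ∑ℚ-*ˡ []       c f = sym (ℚₚ.*-zeroʳ c)
  ∑ℚ-*ˡ (x ∷ xs) c f = trans (cong (c ℚ.* f x ℚ.+_) (∑ℚ-*ˡ xs c f)) (sym (ℚₚ.*-distribˡ-+ c (f x) _))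

  ∑ℚ-ι : ∀ (xs : List A) f → ∑ℚ xs (λ x → ι (f x)) ≡ ι (∑ xs f)
  ∑ℚ-ι []       f = sym ι-0
  ∑ℚ-ι (x ∷ xs) f = trans (cong (ι (f x) ℚ.+_) (∑ℚ-ι xs f)) (sym (ι-+ (f x) _))

  ∑ℚ-const : ∀ (xs : List A) c → ∑ℚ xs (λ _ → c) ≡ ι (length xs) ℚ.* c
  ∑ℚ-const []       c = sym (trans (cong (ℚ._* c) ι-0) (ℚₚ.*-zeroˡ c))
  ∑ℚ-const (x ∷ xs) c = trans (cong (c ℚ.+_) (∑ℚ-const xs c)) (sym (trans (cong (ℚ._* c) (trans (ι-+ 1 (length xs)) (cong (ℚ._+ ι (length xs)) ι-1))) (expand c (ι (length xs)))))
    where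
    expand : ∀ c m → (1ℚ ℚ.+ m) ℚ.* c ≡ c ℚ.+ m ℚ.* c
    expand = Solver.solve-∀ ℚ-ring

  average : A → List A → (A → ℚ) → ℚ
  average x xs f = ∑ℚ (x ∷ xs) (λ y → (+ 1 / suc (length xs)) ℚ.* f y)

  ∑ℚ-average : ∀ x xs f → ι (suc (length xs)) ℚ.* average x xs f ≡ ∑ℚ (x ∷ xs) f
  ∑ℚ-average x xs f = trans (cong (ι (suc (length xs)) ℚ.*_) (∑ℚ-*ˡ (x ∷ xs) (+ 1 / suc (length xs)) f))
    (trans (sym (ℚₚ.*-assoc (ι (suc (length xs))) (+ 1 / suc (length xs)) (∑ℚ (x ∷ xs) f))) (trans (cong (ℚ._* ∑ℚ (x ∷ xs) f) (ι-inverse (length xs))) (ℚₚ.*-identityˡ _)))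

  ≤-average : ∀ x xs f {c} → (∀ y → c ℚ.≤ f y) → c ℚ.≤ average x xs f
  ≤-average x xs f {c} c≤f = *-cancelˡ {suc (length xs)} (s≤s z≤n) (begin
    ι (suc (length xs)) ℚ.* c              ≡⟨ sym (∑ℚ-const (x ∷ xs) c) ⟩
    ∑ℚ (x ∷ xs) (λ _ → c)                  ≤⟨ ∑ℚ-mono (x ∷ xs) c≤f ⟩
    ∑ℚ (x ∷ xs) f                          ≡⟨ sym (∑ℚ-average x xs f) ⟩
    ι (suc (length xs)) ℚ.* average x xs f ∎)
    where open ℚₚ.≤-Reasoning

  -- Upper bounds `β` on failure probabilities take the form `1 ≤ f + β`, which avoids subtraction
  -- and is preserved by averaging.
  average-deficit : ∀ x xs f β {W} → (∀ y → 1ℚ ℚ.≤ f y ℚ.+ β y) →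
    ∑ℚ (x ∷ xs) β ℚ.≤ ι (suc (length xs)) ℚ.* W → 1ℚ ℚ.≤ average x xs f ℚ.+ W
  average-deficit x xs f β {W} 1≤f+β Σβ≤W = *-cancelˡ {suc (length xs)} (s≤s z≤n) (begin
    d ℚ.* 1ℚ
      ≡⟨ sym (∑ℚ-const (x ∷ xs) 1ℚ) ⟩
    ∑ℚ (x ∷ xs) (λ _ → 1ℚ)
      ≤⟨ ∑ℚ-mono (x ∷ xs) 1≤f+β ⟩
    ∑ℚ (x ∷ xs) (λ y → f y ℚ.+ β y)
      ≡⟨ ∑ℚ-+ (x ∷ xs) f β ⟩
    ∑ℚ (x ∷ xs) f ℚ.+ ∑ℚ (x ∷ xs) β
      ≤⟨ ℚₚ.+-mono-≤ (ℚₚ.≤-reflexive (sym (∑ℚ-average x xs f))) Σβ≤W ⟩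
    d ℚ.* average x xs f ℚ.+ d ℚ.* W
      ≡⟨ sym (ℚₚ.*-distribˡ-+ d (average x xs f) W) ⟩
    d ℚ.* (average x xs f ℚ.+ W) ∎)
    where
    open ℚₚ.≤-Reasoning
    d = ι (suc (length xs))

-- One round of the game

setAcq : ∀ {n} → State n → List (Edge n) → State n
setAcq s es = record s { acq = es }

module Game {n : ℕ} (G : Graph n) (B : Strategy n) where

  mutual
    -- Solved by unification with the body of breakerMove's local function.
    fallbackOn : State n → Fin n → Fin n → List (Edge n) → State n
    fallbackOn = λ s u v es → _

    breakerMove-↝ : ∀ s → ∃ λ es → breakerMove G B s ≡ setAcq s es × acq s ↝ es
    breakerMove-↝ s with B (hist s) (acq s)
    ... | (u , v) with available G s u v
    ...   | true = (u , v) ∷ acq s , refl , acquire (u , v)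
    ...   | false with allEdges G
    ...     | es = fallbackOn-↝ s u v es

    fallbackOn-↝ : ∀ s u v es → ∃ λ es' → fallbackOn s u v es ≡ setAcq s es' × acq s ↝ es'
    fallbackOn-↝ s u v []       = acq s , refl , keep
    fallbackOn-↝ s u v (e ∷ es) with available G s (proj₁ e) (proj₂ e)
    ... | true  = e ∷ acq s , refl , acquire e
    ... | false = fallbackOn-↝ s u v es

  neighbours : State n → List (Fin n)
  neighbours s = filter (λ w → openE G s (pos s) w Bool.≟ true) (allFin n)

  probK-over : ∀ k E s → over G s ≡ true → probK G k B E s ≡ indicator G E s
  probK-over zero    E s _ = refl
  probK-over (suc k) E s eq rewrite eq = refl

  probK-over' : ∀ k E s → over G s ≡ false → over G (breakerMove G B s) ≡ true →
    probK G (suc k) B E s ≡ indicator G E (breakerMove G B s)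
  probK-over' k E s p q rewrite p | q = refl

  probK-stuck : ∀ k E s → over G s ≡ false → over G (breakerMove G B s) ≡ false →
    neighbours (breakerMove G B s) ≡ [] →
    probK G (suc k) B E s ≡ indicator G E (breakerMove G B s)
  probK-stuck k E s p q r rewrite p | q | r = refl

  probK-step : ∀ k E s → over G s ≡ false → over G (breakerMove G B s) ≡ false →
    ∀ {w ws} → neighbours (breakerMove G B s) ≡ w ∷ ws →
    probK G (suc k) B E s ≡ average w ws (λ w → probK G k B E (walkTo G (breakerMove G B s) w))
  probK-step k E s p q r rewrite p | q | r = refl

  -- `stopped` covers both a game that is over after Breaker's move and a walker without an open
  -- edge.
  data Round (k : ℕ) (E : ℕ → Bool) (s : State n) : Set where
    ended   : probK G (suc k) B E s ≡ indicator G E s → Round k E s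
    stopped : probK G (suc k) B E s ≡ indicator G E (breakerMove G B s) → Round k E s
    moved   : ∀ w ws → probK G (suc k) B E s ≡ average w ws (λ w → probK G k B E (walkTo G (breakerMove G B s) w)) → Round k E s

  round : ∀ k E s → Round k E s
  round k E s = after (over G s) refl
    where
    moves : over G s ≡ false → over G (breakerMove G B s) ≡ false → ∀ ws → neighbours (breakerMove G B s) ≡ ws → Round k E s
    moves p q []       r = stopped (probK-stuck k E s p q r)
    moves p q (w ∷ ws) r = moved w ws (probK-step k E s p q r)
    after₂ : over G s ≡ false → ∀ b → over G (breakerMove G B s) ≡ b → Round k E s
    after₂ p true  q = stopped (probK-over' k E s p q)
    after₂ p false q = moves p q _ refl
    after : ∀ b → over G s ≡ b → Round k E s
    after true  p = ended (probK-over (suc k) E s p)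
    after false p = after₂ p _ refl

  -- A property of the history that survives every walker move also holds when the game ends,
  -- whichever of the three ways a round takes.
  indicator≤probK : ∀ E c (P : List (Fin n) → Set) → (∀ h w → P h → P (w ∷ h)) →
    (∀ s → P (hist s) → c ℚ.≤ indicator G E s) → ∀ k s → P (hist s) → c ℚ.≤ probK G k B E s
  indicator≤probK E c P grow base zero    s Ps = base s Ps
  indicator≤probK E c P grow base (suc k) s Ps = conclude (round k E s) (breakerMove-↝ s)
    where
    conclude : Round k E s → (∃ λ es → breakerMove G B s ≡ setAcq s es × acq s ↝ es) → c ℚ.≤ probK G (suc k) B E s
    conclude (ended eq)      _              = subst (c ℚ.≤_) (sym eq) (base s Ps)
    conclude (stopped eq)    (es , eq' , _) = subst (c ℚ.≤_) (sym eq) (subst (λ s → c ℚ.≤ indicator G E s) (sym eq') (base (setAcq s es) Ps))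
    conclude (moved w ws eq) (es , eq' , _) = subst (c ℚ.≤_) (sym eq) (≤-average w ws (λ w → probK G k B E (walkTo G (breakerMove G B s) w))
      (λ w → subst (λ s → c ℚ.≤ probK G k B E (walkTo G s w)) (sym eq')
        (indicator≤probK E c P grow base k (walkTo G (setAcq s es) w) (grow (hist s) w Ps))))

-- The certificate for the failure probability

module Deficit {n : ℕ} (G : Graph n) (B : Strategy n) (R : ℕ) where

  open Game G B

  E : ℕ → Bool
  E k = (n ∸ R) ≤ᵇ k

  visitedCount-+ : ∀ s → visitedCount G s + #unv (hist s) ≡ n
  visitedCount-+ s = trans (cong (_+ #unv (hist s)) (length-filter-∑ (visited G s) (allFin n)))
    (trans (sym (∑-+ (allFin n) _ _)) (trans (∑-cong (allFin n) (λ v → complement (visited G s v)))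
      (trans (∑-one (allFin n)) (length-tabulate id))))
    where
    complement : ∀ b → ⟦ b ⟧ + ⟦ not b ⟧ ≡ 1
    complement true  = refl
    complement false = refl

  0≤probK : ∀ k s → 0ℚ ℚ.≤ probK G k B E s
  0≤probK k s = indicator≤probK E 0ℚ (λ _ → 0 ≤ 0) (λ _ _ z → z) (λ s _ → nonneg (E (visitedCount G s))) k s z≤n
    where
    nonneg : ∀ b → 0ℚ ℚ.≤ (if b then 1ℚ else 0ℚ)
    nonneg true  = ℚₚ.nonNegative⁻¹ 1ℚ
    nonneg false = ℚₚ.≤-refl

  1≤probK : ∀ k s → #unv (hist s) ≤ R → 1ℚ ℚ.≤ probK G k B E s
  1≤probK = indicator≤probK E 1ℚ (λ h → #unv h ≤ R)
    (λ h w u≤R → ≤-trans (≤-trans (m≤m+n _ (unv h w)) (≤-reflexive (#unv-∷ w h))) u≤R)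
    (λ s u≤R → ℚₚ.≤-reflexive (sym (cong (λ b → if b then 1ℚ else 0ℚ) (Equivalence.to T-≡ (≤⇒≤ᵇ (won s u≤R))))))
    where
    won : ∀ s → #unv (hist s) ≤ R → n ∸ R ≤ visitedCount G s
    won s u≤R = m≤n+o⇒m∸n≤o n R (≤-trans (≤-reflexive (sym (visitedCount-+ s)))
      (≤-trans (+-monoʳ-≤ (visitedCount G s) u≤R) (≤-reflexive (+-comm (visitedCount G s) R))))

  -- Induction step for failure bounds: `W` need only dominate the average of the bounds `β` over
  -- the neighbours still open after Breaker's move.
  deficit-step : ∀ k s es → breakerMove G B s ≡ setAcq s es →
    over G s ≡ false → over G (setAcq s es) ≡ false → 1 ≤ odeg G es (pos s) →
    ∀ β W → (∀ w → 1ℚ ℚ.≤ probK G k B E (walkTo G (setAcq s es) w) ℚ.+ β w) →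
    ∑ℚ (neighbours (setAcq s es)) β ℚ.≤ ι (odeg G es (pos s)) ℚ.* W →
    1ℚ ℚ.≤ probK G (suc k) B E s ℚ.+ W
  deficit-step k s es eq p q 1≤d β W 1≤p+β Σβ = go (neighbours (setAcq s es)) refl
    where
    #neighbours : length (neighbours (setAcq s es)) ≡ odeg G es (pos s)
    #neighbours = length-filter-∑ (openE G (setAcq s es) (pos s)) (allFin n)

    go : ∀ ws → neighbours (setAcq s es) ≡ ws → 1ℚ ℚ.≤ probK G (suc k) B E s ℚ.+ W
    go [] r = contradiction (≤-trans 1≤d (≤-reflexive (trans (sym #neighbours) (cong length r)))) λ ()
    go (w ∷ ws) r = subst (λ x → 1ℚ ℚ.≤ x ℚ.+ W)
      (sym (trans (probK-step k E s p (trans (cong (over G) eq) q) (trans (cong neighbours eq) r))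
        (cong (λ t → average w ws (λ w → probK G k B E (walkTo G t w))) eq)))
      (average-deficit w ws (λ w → probK G k B E (walkTo G (setAcq s es) w)) β 1≤p+β
        (subst (λ m → ∑ℚ (w ∷ ws) β ℚ.≤ ι m ℚ.* W) (trans (sym #neighbours) (cong length r))
          (subst (λ l → ∑ℚ l β ℚ.≤ ι (odeg G es (pos s)) ℚ.* W) r Σβ)))

  ∑ℚ-linear : ∀ (xs : List (Fin n)) y κ a c c' (F t b b' : Fin n → ℕ) →
    ∑ℚ xs (λ w → y ℚ.* ι (F w) ℚ.+ (κ ℚ.+ (a ℚ.* ι (t w) ℚ.+ (c ℚ.* ι (b w) ℚ.+ c' ℚ.* ι (b' w)))))
      ≡ y ℚ.* ι (∑ xs F) ℚ.+ (ι (length xs) ℚ.* κ ℚ.+ (a ℚ.* ι (∑ xs t) ℚ.+ (c ℚ.* ι (∑ xs b) ℚ.+ c' ℚ.* ι (∑ xs b'))))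
  ∑ℚ-linear xs y κ a c c' F t b b' =
    plus (λ w → y ℚ.* ι (F w)) (scaled y F) (plus (λ _ → κ) (∑ℚ-const xs κ)
      (plus (λ w → a ℚ.* ι (t w)) (scaled a t) (plus (λ w → c ℚ.* ι (b w)) (scaled c b) (scaled c' b'))))
    where
    scaled : ∀ c f → ∑ℚ xs (λ w → c ℚ.* ι (f w)) ≡ c ℚ.* ι (∑ xs f)
    scaled c f = trans (∑ℚ-*ˡ xs c (λ w → ι (f w))) (cong (c ℚ.*_) (∑ℚ-ι xs f))
    plus : ∀ f {g s t} → ∑ℚ xs f ≡ s → ∑ℚ xs g ≡ t → ∑ℚ xs (λ w → f w ℚ.+ g w) ≡ s ℚ.+ t
    plus f {g} p q = trans (∑ℚ-+ xs f g) (cong₂ ℚ._+_ p q)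

-- Two factors `q` cover the decay of one round at a good vertex, `c` is the initial weight of the
-- unvisited vertices, `a` bounds the reciprocal open degree after Breaker's move at a good vertex,
-- and `r` bounds `L / d` for open degrees `d` of at least `D`.
module Certificate {n : ℕ} (G : Graph n) (B : Strategy n) (A T L D R : ℕ)
  (3≤n : 3 ≤ n) (8A≤n : 8 * A ≤ n) (1≤L : 1 ≤ L) (L≤D : L ≤ D)
  (2L≤R : 2 * L ≤ R) (32A≤R : 32 * A ≤ R)
  (codegree : ∀ u v → u ≢ v → n ≤ A * codeg G u v)
  (bad-count : 8 * A * T ≤ n * L) (D-small : 4 * A * (D + 4) ≤ 2 * n)
  (q c a r : ℚ) (0≤q : 0ℚ ℚ.≤ q) (q≤1 : q ℚ.≤ 1ℚ) (0≤c : 0ℚ ℚ.≤ c) (0≤a : 0ℚ ℚ.≤ a) (0≤r : 0ℚ ℚ.≤ r)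
  (decay : ∀ S X → 16 * A * n * S + X ≤ 16 * A * n * X → ι S ℚ.≤ q ℚ.* (q ℚ.* ι X))
  (1≤qcn : 1ℚ ℚ.≤ q ℚ.* c ℚ.* ι n)
  (1≤da : ∀ d → n ≤ 2 * A * d → 1ℚ ℚ.≤ ι d ℚ.* a)
  (L≤dr : ∀ d → D ≤ d → ι L ℚ.≤ ι d ℚ.* r)
  (exposure-cost : a ℚ.* ι (L * (D + 4)) ℚ.≤ r) where

  open Deficit G B R
  open Game G B
  open Potential G
  open Estimates G A T L D (≤-trans (n≤1+n 2) 3≤n) codegree bad-count D-small
  open Endgame G A T L D 3≤n codegree bad-count D-small

  y : ℕ → ℚ
  y zero    = c
  y (suc k) = q ℚ.* y k

  -- The loss in one round at a good vertex: of the three `r`, one pays for exposure and two for bad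
  -- neighbours.
  δ : ℚ
  δ = a ℚ.* ((r ℚ.+ r ℚ.+ r) ℚ.* ι L)

  0≤y : ∀ k → 0ℚ ℚ.≤ y k
  0≤y zero    = 0≤c
  0≤y (suc k) = 0≤* 0≤q (0≤y k)

  y-decreasing : ∀ k → y (suc k) ℚ.≤ y k
  y-decreasing k = ℚₚ.≤-trans (*-monoʳ (0≤y k) q≤1) (ℚₚ.≤-reflexive (ℚₚ.*-identityˡ (y k)))

  0≤2r : 0ℚ ℚ.≤ r ℚ.+ r
  0≤2r = 0≤+ 0≤r 0≤r

  0≤δ : 0ℚ ℚ.≤ δ
  0≤δ = 0≤* 0≤a (0≤* (0≤+ 0≤2r 0≤r) (0≤ι L))

  -- The exposure, bad and trap sums are bounded independently of `d`; the inequality `1 ≤ d * a`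
  -- turns them into a multiple of `d`. The unvisited term gains the factor `q * q`.
  good-round : ∀ y₀ κ d F SF Sτ Sb St τ → 0ℚ ℚ.≤ y₀ → n ≤ 2 * A * d →
    16 * A * n * SF + d * F ≤ 16 * A * n * (d * F) → Sτ ≤ L * (D + 4) → Sb ≤ L → St ≤ τ →
    y₀ ℚ.* ι SF ℚ.+ (ι d ℚ.* κ ℚ.+ (a ℚ.* ι Sτ ℚ.+ ((r ℚ.+ r) ℚ.* ι Sb ℚ.+ 1ℚ ℚ.* ι St)))
      ℚ.≤ ι d ℚ.* (q ℚ.* (q ℚ.* y₀) ℚ.* ι F ℚ.+ ((κ ℚ.+ δ) ℚ.+ a ℚ.* ι τ))
  good-round y₀ κ d F SF Sτ Sb St τ 0≤y₀ n≤d hF hτ hb ht = begin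
    y₀ ℚ.* ι SF ℚ.+ (ι d ℚ.* κ ℚ.+ (a ℚ.* ι Sτ ℚ.+ ((r ℚ.+ r) ℚ.* ι Sb ℚ.+ 1ℚ ℚ.* ι St)))
      ≤⟨ ℚₚ.+-mono-≤ (*-monoˡ 0≤y₀ (decay SF (d * F) hF)) (ℚₚ.+-monoʳ-≤ (ι d ℚ.* κ)
           (ℚₚ.+-mono-≤ (ℚₚ.≤-trans (*-monoˡ 0≤a (ι-mono hτ)) exposure-cost)
             (ℚₚ.+-mono-≤ (*-monoˡ 0≤2r (ι-mono hb)) (*-monoˡ {1ℚ} (ℚₚ.nonNegative⁻¹ 1ℚ) (ι-mono ht))))) ⟩
    y₀ ℚ.* (q ℚ.* (q ℚ.* ι (d * F))) ℚ.+ (ι d ℚ.* κ ℚ.+ (r ℚ.+ ((r ℚ.+ r) ℚ.* ι L ℚ.+ 1ℚ ℚ.* ι τ)))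
      ≡⟨ cong (λ x → y₀ ℚ.* (q ℚ.* (q ℚ.* x)) ℚ.+ (ι d ℚ.* κ ℚ.+ (r ℚ.+ ((r ℚ.+ r) ℚ.* ι L ℚ.+ 1ℚ ℚ.* ι τ)))) (ι-* d F) ⟩
    y₀ ℚ.* (q ℚ.* (q ℚ.* (ι d ℚ.* ι F))) ℚ.+ (ι d ℚ.* κ ℚ.+ (r ℚ.+ ((r ℚ.+ r) ℚ.* ι L ℚ.+ 1ℚ ℚ.* ι τ)))
      -- `1 ≤ L` rounds the exposure cost `r` up to `r * L`, to merge it with the bad neighbours'
      -- share.
      ≤⟨ ℚₚ.+-monoʳ-≤ (y₀ ℚ.* (q ℚ.* (q ℚ.* (ι d ℚ.* ι F)))) (ℚₚ.+-monoʳ-≤ (ι d ℚ.* κ) (ℚₚ.+-monoˡ-≤ ((r ℚ.+ r) ℚ.* ι L ℚ.+ 1ℚ ℚ.* ι τ) r≤rL)) ⟩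
    y₀ ℚ.* (q ℚ.* (q ℚ.* (ι d ℚ.* ι F))) ℚ.+ (ι d ℚ.* κ ℚ.+ (r ℚ.* ι L ℚ.+ ((r ℚ.+ r) ℚ.* ι L ℚ.+ 1ℚ ℚ.* ι τ)))
      ≡⟨ collect y₀ q (ι d) (ι F) κ r (ι L) (ι τ) ⟩
    (y₀ ℚ.* (q ℚ.* (q ℚ.* (ι d ℚ.* ι F))) ℚ.+ ι d ℚ.* κ) ℚ.+ 1ℚ ℚ.* ((r ℚ.+ r ℚ.+ r) ℚ.* ι L ℚ.+ ι τ)
      ≤⟨ ℚₚ.+-monoʳ-≤ (y₀ ℚ.* (q ℚ.* (q ℚ.* (ι d ℚ.* ι F))) ℚ.+ ι d ℚ.* κ)
           (*-monoʳ (0≤+ (0≤* (0≤+ 0≤2r 0≤r) (0≤ι L)) (0≤ι τ)) (1≤da d n≤d)) ⟩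
    (y₀ ℚ.* (q ℚ.* (q ℚ.* (ι d ℚ.* ι F))) ℚ.+ ι d ℚ.* κ) ℚ.+ ι d ℚ.* a ℚ.* ((r ℚ.+ r ℚ.+ r) ℚ.* ι L ℚ.+ ι τ)
      ≡⟨ factor y₀ q (ι d) (ι F) κ r (ι L) (ι τ) a ⟩
    ι d ℚ.* (q ℚ.* (q ℚ.* y₀) ℚ.* ι F ℚ.+ ((κ ℚ.+ δ) ℚ.+ a ℚ.* ι τ)) ∎
    where
    open ℚₚ.≤-Reasoning
    r≤rL : r ℚ.≤ r ℚ.* ι L
    r≤rL = ℚₚ.≤-trans (ℚₚ.≤-reflexive (sym (trans (cong (r ℚ.*_) ι-1) (ℚₚ.*-identityʳ r)))) (*-monoˡ 0≤r (ι-mono 1≤L))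
    collect : ∀ y₀ q d F κ r L τ →
      y₀ ℚ.* (q ℚ.* (q ℚ.* (d ℚ.* F))) ℚ.+ (d ℚ.* κ ℚ.+ (r ℚ.* L ℚ.+ ((r ℚ.+ r) ℚ.* L ℚ.+ 1ℚ ℚ.* τ)))
        ≡ (y₀ ℚ.* (q ℚ.* (q ℚ.* (d ℚ.* F))) ℚ.+ d ℚ.* κ) ℚ.+ 1ℚ ℚ.* ((r ℚ.+ r ℚ.+ r) ℚ.* L ℚ.+ τ)
    collect = Solver.solve-∀ ℚ-ring
    factor : ∀ y₀ q d F κ r L τ a →
      (y₀ ℚ.* (q ℚ.* (q ℚ.* (d ℚ.* F))) ℚ.+ d ℚ.* κ) ℚ.+ d ℚ.* a ℚ.* ((r ℚ.+ r ℚ.+ r) ℚ.* L ℚ.+ τ)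
        ≡ d ℚ.* (q ℚ.* (q ℚ.* y₀) ℚ.* F ℚ.+ ((κ ℚ.+ a ℚ.* ((r ℚ.+ r ℚ.+ r) ℚ.* L)) ℚ.+ a ℚ.* τ))
    factor = Solver.solve-∀ ℚ-ring

  -- Without decay, exposure and bad neighbours cost one `r` per choice each. Traps have weight 0
  -- because they are bad and so already charged in full.
  sparse-round : ∀ y₀ κ d F SF Sτ Sb St → 0ℚ ℚ.≤ y₀ → D ≤ d →
    SF ≤ d * F → Sτ ≤ L * (D + 4) → Sb ≤ L →
    y₀ ℚ.* ι SF ℚ.+ (ι d ℚ.* κ ℚ.+ (a ℚ.* ι Sτ ℚ.+ (1ℚ ℚ.* ι Sb ℚ.+ 0ℚ ℚ.* ι St)))
      ℚ.≤ ι d ℚ.* (y₀ ℚ.* ι F ℚ.+ ((κ ℚ.+ δ) ℚ.+ (r ℚ.+ r)))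
  sparse-round y₀ κ d F SF Sτ Sb St 0≤y₀ D≤d hF hτ hb = begin
    y₀ ℚ.* ι SF ℚ.+ (ι d ℚ.* κ ℚ.+ (a ℚ.* ι Sτ ℚ.+ (1ℚ ℚ.* ι Sb ℚ.+ 0ℚ ℚ.* ι St)))
      ≤⟨ ℚₚ.+-mono-≤ (*-monoˡ 0≤y₀ (ι-mono hF)) (ℚₚ.+-monoʳ-≤ (ι d ℚ.* κ)
           (ℚₚ.+-mono-≤ (ℚₚ.≤-trans (*-monoˡ 0≤a (ι-mono hτ)) (ℚₚ.≤-trans exposure-cost r≤dr))
             (ℚₚ.+-monoˡ-≤ (0ℚ ℚ.* ι St) (*-monoˡ {1ℚ} (ℚₚ.nonNegative⁻¹ 1ℚ) (ℚₚ.≤-trans (ι-mono hb) (L≤dr d D≤d)))))) ⟩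
    y₀ ℚ.* ι (d * F) ℚ.+ (ι d ℚ.* κ ℚ.+ (ι d ℚ.* r ℚ.+ (1ℚ ℚ.* (ι d ℚ.* r) ℚ.+ 0ℚ ℚ.* ι St)))
      ≡⟨ trans (cong (λ x → y₀ ℚ.* x ℚ.+ (ι d ℚ.* κ ℚ.+ (ι d ℚ.* r ℚ.+ (1ℚ ℚ.* (ι d ℚ.* r) ℚ.+ 0ℚ ℚ.* ι St)))) (ι-* d F))
           (factor y₀ (ι d) (ι F) κ r (ι St)) ⟩
    ι d ℚ.* (y₀ ℚ.* ι F ℚ.+ (κ ℚ.+ (r ℚ.+ r)))
      ≤⟨ *-monoˡ (0≤ι d) (ℚₚ.+-monoʳ-≤ (y₀ ℚ.* ι F) (ℚₚ.+-monoˡ-≤ (r ℚ.+ r) (p≤p+q {κ} 0≤δ))) ⟩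
    ι d ℚ.* (y₀ ℚ.* ι F ℚ.+ ((κ ℚ.+ δ) ℚ.+ (r ℚ.+ r))) ∎
    where
    open ℚₚ.≤-Reasoning
    r≤dr : r ℚ.≤ ι d ℚ.* r
    r≤dr = ℚₚ.≤-trans (ℚₚ.≤-reflexive (sym (trans (cong (ℚ._* r) ι-1) (ℚₚ.*-identityˡ r))))
      (*-monoʳ 0≤r (ι-mono (≤-trans 1≤L (≤-trans L≤D D≤d))))
    factor : ∀ y₀ d F κ r St →
      y₀ ℚ.* (d ℚ.* F) ℚ.+ (d ℚ.* κ ℚ.+ (d ℚ.* r ℚ.+ (1ℚ ℚ.* (d ℚ.* r) ℚ.+ 0ℚ ℚ.* St)))
        ≡ d ℚ.* (y₀ ℚ.* F ℚ.+ (κ ℚ.+ (r ℚ.+ r)))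
    factor = Solver.solve-∀ ℚ-ring

  bad≡1 : ∀ es v → ¬ 4 * A * bdeg es v ≤ n → bad es v ≡ 1
  bad≡1 es v ¬p with 4 * A * bdeg es v ≤? n
  ... | yes p = contradiction p ¬p
  ... | no _  = refl

  trap≡1 : ∀ es v → odeg G es v ≤ D + 2 → trap es v ≡ 1
  trap≡1 es v p with odeg G es v ≤? D + 2
  ... | yes _ = refl
  ... | no ¬p = contradiction p ¬p

  module _ (j : ℕ) where

    -- The certificate covers `k` rounds; `j` is the fuel left beyond them.
    P : ℕ → State n → ℚ
    P k s = probK G (k + j) B E s

    F : State n → ℕ
    F s = expectedUnv (acq s) (hist s) (pos s)

    exposed : State n → ℕ
    exposed s = exposure (acq s) (pos s)

    -- The three terms bound the probability of too many unvisited vertices after k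
    -- rounds, of entering a trap or two bad vertices in a row later on, and of doing
    -- so at once.  The sparse bound has one factor q less, so a bad vertex makes up for
    -- its missing decay by the factor q * q gained at a good one.
    Good Sparse : ℕ → State n → Set
    Good k s = 4 * A * bdeg (acq s) (pos s) ≤ n →
      1ℚ ℚ.≤ P k s ℚ.+ (y (suc k) ℚ.* ι (F s) ℚ.+ (ι k ℚ.* δ ℚ.+ a ℚ.* ι (exposed s)))
    Sparse k s = D + 2 < odeg G (acq s) (pos s) →
      1ℚ ℚ.≤ P k s ℚ.+ (y k ℚ.* ι (F s) ℚ.+ (ι k ℚ.* δ ℚ.+ (r ℚ.+ r)))

    slack : ∀ {p x x'} → 1ℚ ℚ.≤ p ℚ.+ x → x ℚ.≤ x' → 1ℚ ℚ.≤ p ℚ.+ x'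
    slack {p} h x≤x' = ℚₚ.≤-trans h (ℚₚ.+-monoʳ-≤ p x≤x')

    0≤aι : ∀ m → 0ℚ ℚ.≤ a ℚ.* ι m
    0≤aι m = 0≤* 0≤a (0≤ι m)

    0≤yι : ∀ k m → 0ℚ ℚ.≤ y k ℚ.* ι m
    0≤yι k m = 0≤* (0≤y k) (0≤ι m)

    0≤kδ : ∀ k → 0ℚ ℚ.≤ ι k ℚ.* δ
    0≤kδ k = 0≤* (0≤ι k) 0≤δ

    0≤1ι : ∀ m → 0ℚ ℚ.≤ 1ℚ ℚ.* ι m
    0≤1ι m = 0≤* (ℚₚ.nonNegative⁻¹ 1ℚ) (0≤ι m)

    0≤0ι : ∀ m → 0ℚ ℚ.≤ 0ℚ ℚ.* ι m
    0≤0ι m = 0≤* ℚₚ.≤-refl (0≤ι m)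

    1≤1ι : ∀ {m} → m ≡ 1 → 1ℚ ℚ.≤ 1ℚ ℚ.* ι m
    1≤1ι refl = ℚₚ.≤-reflexive (sym (trans (ℚₚ.*-identityˡ (ι 1)) ι-1))

    c*ι1 : ∀ c {m} → m ≡ 1 → c ℚ.≤ c ℚ.* ι m
    c*ι1 c refl = ℚₚ.≤-reflexive (sym (trans (cong (c ℚ.*_) ι-1) (ℚₚ.*-identityʳ c)))

    deficit≤1 : ∀ k s {x} → 1ℚ ℚ.≤ x → 1ℚ ℚ.≤ P k s ℚ.+ x
    deficit≤1 k s 1≤x = ℚₚ.≤-trans 1≤x (p≤q+p (0≤probK (k + j) s))

    won : ∀ k s {x} → #unv (hist s) ≤ R → 0ℚ ℚ.≤ x → 1ℚ ℚ.≤ P k s ℚ.+ x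
    won k s u≤R 0≤x = ℚₚ.≤-trans (1≤probK (k + j) s u≤R) (p≤p+q 0≤x)

    module _ (k : ℕ) (t : State n) (ih : R < #unv (hist t) → Good k t × Sparse k t) where

      private
        es = acq t
        v  = pos t
        κ  = ι k ℚ.* δ

      GoodBound SparseBound : Set
      GoodBound = 1ℚ ℚ.≤ P k t ℚ.+ (y k ℚ.* ι (F t) ℚ.+
        (κ ℚ.+ (a ℚ.* ι (exposed t) ℚ.+ ((r ℚ.+ r) ℚ.* ι (bad es v) ℚ.+ 1ℚ ℚ.* ι (trap es v)))))
      SparseBound = 1ℚ ℚ.≤ P k t ℚ.+ (y (suc k) ℚ.* ι (F t) ℚ.+
        (κ ℚ.+ (a ℚ.* ι (exposed t) ℚ.+ (1ℚ ℚ.* ι (bad es v) ℚ.+ 0ℚ ℚ.* ι (trap es v)))))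

      -- A good vertex satisfies `Good`; a bad one outside the traps satisfies `Sparse`, whose
      -- `r + r` is paid by the weight of `bad`; a trap is conceded as a failure.
      after-good : GoodBound
      after-good = decide (#unv (hist t) ≤? R) (4 * A * bdeg es v ≤? n) (odeg G es v ≤? D + 2)
        where
        decide : Dec (#unv (hist t) ≤ R) → Dec (4 * A * bdeg es v ≤ n) → Dec (odeg G es v ≤ D + 2) → GoodBound
        decide (yes u≤R) _ _ = won k t u≤R (0≤+ (0≤yι k (F t)) (0≤+ (0≤kδ k) (0≤+ (0≤aι (exposed t))
          (0≤+ (0≤* 0≤2r (0≤ι (bad es v))) (0≤1ι (trap es v))))))
        decide (no u≰R) (yes g) _ = slack {P k t} (proj₁ (ih (≰⇒> u≰R)) g)
          (ℚₚ.+-mono-≤ (*-monoʳ (0≤ι (F t)) (y-decreasing k))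
            (ℚₚ.+-monoʳ-≤ κ (p≤p+q {a ℚ.* ι (exposed t)} (0≤+ (0≤* 0≤2r (0≤ι (bad es v))) (0≤1ι (trap es v))))))
        decide (no u≰R) (no ¬g) (no ¬l) = slack {P k t} (proj₂ (ih (≰⇒> u≰R)) (≰⇒> ¬l))
          (ℚₚ.+-monoʳ-≤ (y k ℚ.* ι (F t)) (ℚₚ.+-monoʳ-≤ κ
            (ℚₚ.≤-trans (c*ι1 (r ℚ.+ r) (bad≡1 es v ¬g))
              (ℚₚ.≤-trans (p≤p+q {(r ℚ.+ r) ℚ.* ι (bad es v)} (0≤1ι (trap es v))) (p≤q+p (0≤aι (exposed t)))))))
        decide (no _) (no _) (yes l) = deficit≤1 k t (ℚₚ.≤-trans (1≤1ι (trap≡1 es v l))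
          (ℚₚ.≤-trans (p≤q+p (0≤* 0≤2r (0≤ι (bad es v)))) (ℚₚ.≤-trans (p≤q+p (0≤aι (exposed t)))
            (ℚₚ.≤-trans (p≤q+p (0≤kδ k)) (p≤q+p (0≤yι k (F t)))))))

      -- Arrival at a bad vertex is conceded as a failure here, so only `Good` is needed from the
      -- induction.
      after-sparse : SparseBound
      after-sparse = decide (#unv (hist t) ≤? R) (4 * A * bdeg es v ≤? n)
        where
        decide : Dec (#unv (hist t) ≤ R) → Dec (4 * A * bdeg es v ≤ n) → SparseBound
        decide (yes u≤R) _ = won k t u≤R (0≤+ (0≤yι (suc k) (F t)) (0≤+ (0≤kδ k) (0≤+ (0≤aι (exposed t))
          (0≤+ (0≤1ι (bad es v)) (0≤0ι (trap es v))))))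
        decide (no u≰R) (yes g) = slack {P k t} (proj₁ (ih (≰⇒> u≰R)) g)
          (ℚₚ.+-monoʳ-≤ (y (suc k) ℚ.* ι (F t))
            (ℚₚ.+-monoʳ-≤ κ (p≤p+q {a ℚ.* ι (exposed t)} (0≤+ (0≤1ι (bad es v)) (0≤0ι (trap es v))))))
        decide (no _) (no ¬g) = deficit≤1 k t (ℚₚ.≤-trans (1≤1ι (bad≡1 es v ¬g))
          (ℚₚ.≤-trans (p≤p+q {1ℚ ℚ.* ι (bad es v)} (0≤0ι (trap es v))) (ℚₚ.≤-trans (p≤q+p (0≤aι (exposed t)))
            (ℚₚ.≤-trans (p≤q+p (0≤kδ k)) (p≤q+p (0≤yι (suc k) (F t)))))))

    module _ (k : ℕ) (s : State n) (es : List (Edge n)) (eq : breakerMove G B s ≡ setAcq s es)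
      (m : acq s ↝ es) (budget : length es + k ≤ T) (R<u : R < #unv (hist s))
      (ih : ∀ t → length (acq t) + k ≤ T → R < #unv (hist t) → Good k t × Sparse k t) where

      private
        s' : State n
        s' = setAcq s es
        v = pos s
        h = hist s
        d = odeg G es v
        κ = ι k ℚ.* δ
        es≤T : length es ≤ T
        es≤T = ≤-trans (m≤m+n (length es) k) budget
        acq≤T : length (acq s) ≤ T
        acq≤T = ≤-trans (acquired≤ m) es≤T
          where
          acquired≤ : ∀ {es es' : List (Edge n)} → es ↝ es' → length es ≤ length es'
          acquired≤ keep        = ≤-refl
          acquired≤ (acquire e) = n≤1+n _
        L<u : L < #unv h
        L<u = ≤-<-trans (≤-trans (m≤n*m L 2) 2L≤R) R<u

      -- Breaker adds at most 2 to the acquired degree, which costs `8 * A ≤ n`.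
      mobile-after : (4 * A * bdeg (acq s) v ≤ n → 4 * A * bdeg es v ≤ 2 * n)
      mobile-after g = begin
        4 * A * bdeg es v
          ≤⟨ *-monoʳ-≤ (4 * A) (bdeg-↝ G m v) ⟩
        4 * A * (2 + bdeg (acq s) v)
          ≡⟨ expand A (bdeg (acq s) v) ⟩
        8 * A + 4 * A * bdeg (acq s) v
          ≤⟨ +-mono-≤ 8A≤n g ⟩
        n + n
          ≡⟨ cong (λ m → n + m) (sym (+-identityʳ n)) ⟩
        2 * n ∎
        where
        open ≤-Reasoning
        expand : ∀ A b → 4 * A * (2 + b) ≡ 8 * A + 4 * A * b
        expand = solve-∀

      ∑-neighbours : ∀ f → ∑ (neighbours s') f ≡ ∑[ w ∈ V ] (opn G es v w * f w)
      ∑-neighbours f = ∑-filter (openE G s' v) V f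

      ∑-bound : ∀ y₀ c c' →
        ∑ℚ (neighbours s') (λ w → y₀ ℚ.* ι (expectedUnv es (w ∷ h) w) ℚ.+
          (κ ℚ.+ (a ℚ.* ι (exposure es w) ℚ.+ (c ℚ.* ι (bad es w) ℚ.+ c' ℚ.* ι (trap es w)))))
        ≡ y₀ ℚ.* ι (∑[ w ∈ V ] (opn G es v w * expectedUnv es (w ∷ h) w)) ℚ.+
          (ι d ℚ.* κ ℚ.+ (a ℚ.* ι (∑[ w ∈ V ] (opn G es v w * exposure es w)) ℚ.+
            (c ℚ.* ι (∑[ w ∈ V ] (opn G es v w * bad es w)) ℚ.+ c' ℚ.* ι (∑[ w ∈ V ] (opn G es v w * trap es w)))))
      ∑-bound y₀ c c' = trans (∑ℚ-linear (neighbours s') y₀ κ a c c' (λ w → expectedUnv es (w ∷ h) w) (exposure es) (bad es) (trap es))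
        (cong₂ ℚ._+_ (cong (λ x → y₀ ℚ.* ι x) (∑-neighbours (λ w → expectedUnv es (w ∷ h) w)))
          (cong₂ ℚ._+_ (cong (λ x → ι x ℚ.* κ) (length-filter-∑ (openE G s' v) V))
            (cong₂ ℚ._+_ (cong (λ x → a ℚ.* ι x) (∑-neighbours (exposure es)))
              (cong₂ ℚ._+_ (cong (λ x → c ℚ.* ι x) (∑-neighbours (bad es)))
                (cong (λ x → c' ℚ.* ι x) (∑-neighbours (trap es)))))))

      1+kδ : ∀ x z → x ℚ.+ ((κ ℚ.+ δ) ℚ.+ z) ≡ x ℚ.+ (ι (suc k) ℚ.* δ ℚ.+ z)
      1+kδ x z = cong (λ i → x ℚ.+ (i ℚ.+ z)) (trans (unit (ι k) δ)
        (cong (ℚ._* δ) (trans (cong (ℚ._+ ι k) (sym ι-1)) (sym (ι-+ 1 k)))))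
        where
        unit : ∀ i d → i ℚ.* d ℚ.+ d ≡ (1ℚ ℚ.+ i) ℚ.* d
        unit = Solver.solve-∀ ℚ-ring

      -- The successor may be bad, so its bound carries the larger weight `y k`; the decay `q * q`
      -- turns this into `y (2 + k)`.
      step-good : Good (suc k) s
      step-good g = subst (λ x → 1ℚ ℚ.≤ P (suc k) s ℚ.+ x) (1+kδ (y (2 + k) ℚ.* ι (F s)) (a ℚ.* ι (exposed s)))
        (deficit-step (k + j) s es eq
          (mobile⇒not-over s acq≤T L<u (inj₁ (≤-trans g (m≤n*m n 2))))
          (mobile⇒not-over s' es≤T L<u (inj₁ (mobile-after g)))
          (positive d n≤2Ad) _ _
          (λ w → after-good k (walkTo G s' w) (ih (walkTo G s' w) budget))
          (ℚₚ.≤-trans (ℚₚ.≤-reflexive (∑-bound (y k) (r ℚ.+ r) 1ℚ))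
            (good-round (y k) κ d (F s) _ _ _ _ (exposed s) (0≤y k) n≤2Ad
              (∑-expectedUnv-good h (≤-trans 2L≤R (<⇒≤ R<u)) (≤-trans 32A≤R (<⇒≤ R<u)) m v es≤T (mobile-after g))
              (∑-exposure es v es≤T) (∑-bad es v es≤T) (∑-trap m v))))
        where
        n≤2Ad : n ≤ 2 * A * d
        n≤2Ad = odeg-large es v (mobile-after g)
        positive : ∀ d → n ≤ 2 * A * d → 1 ≤ d
        positive (suc d) _ = s≤s z≤n
        positive zero    p = contradiction (≤-trans 1≤n (≤-trans p (≤-reflexive (*-zeroʳ (2 * A))))) λ ()

      -- A good successor carries `y (suc k)`, which is exactly the weight claimed here, so a round
      -- without decay suffices.
      step-sparse : Sparse (suc k) s
      step-sparse D+2<o = subst (λ x → 1ℚ ℚ.≤ P (suc k) s ℚ.+ x) (1+kδ (y (suc k) ℚ.* ι (F s)) (r ℚ.+ r))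
        (deficit-step (k + j) s es eq
          (mobile⇒not-over s acq≤T L<u (inj₂ (≤-<-trans (≤-trans L≤D (m≤m+n D 2)) D+2<o)))
          (mobile⇒not-over s' es≤T L<u (inj₂ (≤-<-trans L≤D D<d)))
          (≤-trans (s≤s z≤n) D<d) _ _
          (λ w → after-sparse k (walkTo G s' w) (ih (walkTo G s' w) budget))
          (ℚₚ.≤-trans (ℚₚ.≤-reflexive (∑-bound (y (suc k)) 1ℚ 0ℚ))
            (sparse-round (y (suc k)) κ d (F s) _ _ _ _ (0≤y (suc k)) (<⇒≤ D<d)
              (∑-expectedUnv≤ 1≤n m h v) (∑-exposure es v es≤T) (∑-bad es v es≤T))))
        where
        D<d : D < d
        D<d = +-cancelˡ-≤ 2 (suc D) d (≤-trans (≤-reflexive (cong suc (+-comm 2 D)))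
          (≤-trans D+2<o (odeg-↝ G m v)))

    -- With no rounds left the unvisited term alone is at least 1. The budget keeps the acquired
    -- edges at most `T` in number, so the bound `L` on bad vertices holds throughout.
    certificate : ∀ k s → length (acq s) + k ≤ T → R < #unv (hist s) → Good k s × Sparse k s
    certificate zero s _ R<u =
      (λ _ → deficit≤1 0 s (ℚₚ.≤-trans 1≤y₁F (p≤p+q (0≤+ (0≤kδ 0) (0≤aι (exposed s)))))) ,
      (λ _ → deficit≤1 0 s (ℚₚ.≤-trans 1≤y₁F (ℚₚ.≤-trans (*-monoʳ (0≤ι (F s)) (y-decreasing 0)) (p≤p+q (0≤+ (0≤kδ 0) 0≤2r)))))
      where
      2≤u : 2 ≤ #unv (hist s)
      2≤u = ≤-trans (*-monoʳ-≤ 2 1≤L) (≤-trans 2L≤R (<⇒≤ R<u))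
      1≤y₁F : 1ℚ ℚ.≤ y 1 ℚ.* ι (F s)
      1≤y₁F = ℚₚ.≤-trans 1≤qcn (*-monoˡ (0≤y 1) (ι-mono
        (n≤expectedUnv (acq s) (hist s) (pos s) (≤-trans (n≤1+n 2) 3≤n) 2≤u)))
    certificate (suc k) s budget R<u = conclude (breakerMove-↝ s)
      where
      conclude : (∃ λ es → breakerMove G B s ≡ setAcq s es × acq s ↝ es) → Good (suc k) s × Sparse (suc k) s
      conclude (es , eq , m) = step-good k s es eq m budget' R<u (certificate k) , step-sparse k s es eq m budget' R<u (certificate k)
        where
        budget' : length es + k ≤ T
        budget' = ≤-trans (+-monoˡ-≤ k (length-↝ G m)) (≤-trans (≤-reflexive (sym (+-suc (length (acq s)) k))) budget)

-- Logarithms and exponential decay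

n<2^n : ∀ n → n < 2 ^ n
n<2^n zero    = s≤s z≤n
n<2^n (suc n) = ≤-trans (+-mono-≤ (≤-trans (s≤s z≤n) (n<2^n n)) (n<2^n n))
  (≤-reflexive (cong (λ m → 2 ^ n + m) (sym (+-identityʳ (2 ^ n)))))

n≤2*2^log : ∀ n → n ≤ 2 * 2 ^ ⌊log₂ n ⌋
n≤2*2^log n with 2 ^ suc ⌊log₂ n ⌋ ≤? n
... | no ¬p = <⇒≤ (≰⇒> ¬p)
... | yes p = contradiction (≤-trans (≤-reflexive (sym (⌊log₂[2^n]⌋≡n (suc ⌊log₂ n ⌋)))) (⌊log₂⌋-mono-≤ p)) (<⇒≱ (n<1+n _))

2^log≤n : ∀ n → 1 ≤ n → 2 ^ ⌊log₂ n ⌋ ≤ n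
2^log≤n = <-rec (λ n → 1 ≤ n → 2 ^ ⌊log₂ n ⌋ ≤ n) step
  where
  step : ∀ n → (∀ {m} → m < n → 1 ≤ m → 2 ^ ⌊log₂ m ⌋ ≤ m) → 1 ≤ n → 2 ^ ⌊log₂ n ⌋ ≤ n
  step 1 ih _ = ≤-refl
  step n@(suc (suc k)) ih _ = begin
    2 ^ ⌊log₂ n ⌋
      ≡⟨ cong (2 ^_) (trans (sym (m∸n+n≡m 1≤log)) (+-comm (⌊log₂ n ⌋ ∸ 1) 1)) ⟩
    2 * 2 ^ (⌊log₂ n ⌋ ∸ 1)
      ≡⟨ cong (λ l → 2 * 2 ^ l) (sym (⌊log₂⌊n/2⌋⌋≡⌊log₂n⌋∸1 n)) ⟩
    2 * 2 ^ ⌊log₂ ⌊ n /2⌋ ⌋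
      ≤⟨ *-monoʳ-≤ 2 (ih (⌊n/2⌋<n (suc k)) (s≤s z≤n)) ⟩
    2 * ⌊ n /2⌋
      ≤⟨ +-monoʳ-≤ ⌊ n /2⌋ (≤-trans (≤-reflexive (+-identityʳ ⌊ n /2⌋)) (⌊n/2⌋≤⌈n/2⌉ n)) ⟩
    ⌊ n /2⌋ + ⌈ n /2⌉
      ≡⟨ ⌊n/2⌋+⌈n/2⌉≡n n ⟩
    n ∎
    where
    open ≤-Reasoning
    1≤log : 1 ≤ ⌊log₂ n ⌋
    1≤log = ⌊log₂⌋-mono-≤ {2} {n} (s≤s (s≤s z≤n))

^-distribʳ-* : ∀ a b k → (a * b) ^ k ≡ a ^ k * b ^ k
^-distribʳ-* a b zero    = refl
^-distribʳ-* a b (suc k) = trans (cong (a * b *_) (^-distribʳ-* a b k)) (interchange a b (a ^ k) (b ^ k))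
  where
  interchange : ∀ a b c d → a * b * (c * d) ≡ a * c * (b * d)
  interchange = solve-∀

-- With `e = d + 1` and `x = 2 ^ (l / e)`, one has `l ≤ e * x`. One of the `e` factors of
-- `x ^ e ≤ 2 ^ l` absorbs the constant `C * e ^ d`.
polynomial≤exponential : ∀ C d → ∃ λ l₀ → ∀ l → l₀ ≤ l → C * l ^ d ≤ 2 ^ l
polynomial≤exponential C d = C * e ^ d * e , bound
  where
  open ≤-Reasoning
  e = suc d
  bound : ∀ l → C * e ^ d * e ≤ l → C * l ^ d ≤ 2 ^ l
  bound l l₀≤l = begin
    C * l ^ d
      ≤⟨ *-monoʳ-≤ C (^-monoˡ-≤ d l≤ex) ⟩
    C * (e * x) ^ d
      ≡⟨ trans (cong (C *_) (^-distribʳ-* e x d)) (sym (*-assoc C (e ^ d) (x ^ d))) ⟩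
    C * e ^ d * x ^ d
      ≤⟨ *-monoˡ-≤ (x ^ d) (≤-trans C≤s (<⇒≤ (n<2^n s))) ⟩
    x ^ e
      ≡⟨ ^-*-assoc 2 s e ⟩
    2 ^ (s * e)
      ≤⟨ ^-monoʳ-≤ 2 (m/n*n≤m l e) ⟩
    2 ^ l ∎
    where
    s = l ℕ./ e
    x = 2 ^ s
    C≤s : C * e ^ d ≤ s
    C≤s = ≤-trans (≤-reflexive (sym (m*n/n≡m (C * e ^ d) e))) (/-monoˡ-≤ e l₀≤l)
    l≤ex : l ≤ e * x
    l≤ex = begin
      l
        ≡⟨ m≡m%n+[m/n]*n l e ⟩
      l % e + s * e
        ≤⟨ +-monoˡ-≤ (s * e) (<⇒≤ (m%n<n l e)) ⟩
      suc s * e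
        ≤⟨ *-monoˡ-≤ e (n<2^n s) ⟩
      x * e
        ≡⟨ *-comm x e ⟩
      e * x ∎

polylog≤n : ∀ C d → ∃ λ N → ∀ n → N ≤ n → 1 ≤ ⌊log₂ n ⌋ × C * ⌊log₂ n ⌋ ^ d ≤ n
polylog≤n C d with polynomial≤exponential C d
-- The exponent `suc l₀` also makes the logarithm positive.
... | l₀ , bound = 2 ^ suc l₀ , λ n N≤n →
  let 1+l₀≤log = ≤-trans (≤-reflexive (sym (⌊log₂[2^n]⌋≡n (suc l₀)))) (⌊log₂⌋-mono-≤ N≤n)
  in ≤-trans (s≤s z≤n) 1+l₀≤log ,
     ≤-trans (bound ⌊log₂ n ⌋ (≤-trans (n≤1+n l₀) 1+l₀≤log)) (2^log≤n n (≤-trans (m^n>0 2 (suc l₀)) N≤n))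

reciprocal : ∀ {m} → 1 ≤ m → ∃ λ r → 0ℚ ℚ.≤ r × ι m ℚ.* r ≡ 1ℚ
reciprocal {suc d} _ = + 1 / suc d , ℚₚ.nonNegative⁻¹ (+ 1 / suc d) {{ℚₚ.normalize-nonNeg 1 (suc d)}} , ι-inverse d

-- Geometric decay from Bernoulli's inequality

module Decay (γ : ℚ) (0≤γ : 0ℚ ℚ.≤ γ) (z : ℕ → ℚ) (0≤z : ∀ k → 0ℚ ℚ.≤ z k)
  (recurrence : ∀ k → z (suc k) ≡ (1ℚ ℚ.+ ℚ.- γ) ℚ.* z k) where

  -- The product of `1 - γ` and `1 + (m + 1) * γ` falls short of `1 + m * γ` by `(m + 1) * γ * γ`,
  -- the term added in the second line of the chain.
  bernoulli : ∀ m k → z (m + k) ℚ.* (1ℚ ℚ.+ ι m ℚ.* γ) ℚ.≤ z k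
  bernoulli zero k = ℚₚ.≤-reflexive (trans (cong (λ i → z k ℚ.* (1ℚ ℚ.+ i ℚ.* γ)) ι-0)
    (trans (cong (λ i → z k ℚ.* (1ℚ ℚ.+ i)) (ℚₚ.*-zeroˡ γ)) (ℚₚ.*-identityʳ (z k))))
  bernoulli (suc m) k = begin
    z (suc m + k) ℚ.* (1ℚ ℚ.+ ι (suc m) ℚ.* γ)
      ≡⟨ cong₂ (λ x i → x ℚ.* (1ℚ ℚ.+ i ℚ.* γ)) (recurrence (m + k)) (trans (ι-+ 1 m) (cong (ℚ._+ ι m) ι-1)) ⟩
    (1ℚ ℚ.+ ℚ.- γ) ℚ.* z (m + k) ℚ.* (1ℚ ℚ.+ (1ℚ ℚ.+ ι m) ℚ.* γ)
      ≤⟨ p≤p+q (0≤* (0≤z (m + k)) (0≤* (0≤+ (ℚₚ.nonNegative⁻¹ 1ℚ) (0≤ι m)) (0≤* 0≤γ 0≤γ))) ⟩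
    (1ℚ ℚ.+ ℚ.- γ) ℚ.* z (m + k) ℚ.* (1ℚ ℚ.+ (1ℚ ℚ.+ ι m) ℚ.* γ) ℚ.+ z (m + k) ℚ.* ((1ℚ ℚ.+ ι m) ℚ.* (γ ℚ.* γ))
      ≡⟨ expand γ (z (m + k)) (ι m) ⟩
    z (m + k) ℚ.* (1ℚ ℚ.+ ι m ℚ.* γ)
      ≤⟨ bernoulli m k ⟩
    z k ∎
    where
    open ℚₚ.≤-Reasoning
    expand : ∀ γ z i → (1ℚ ℚ.+ ℚ.- γ) ℚ.* z ℚ.* (1ℚ ℚ.+ (1ℚ ℚ.+ i) ℚ.* γ) ℚ.+ z ℚ.* ((1ℚ ℚ.+ i) ℚ.* (γ ℚ.* γ))
      ≡ z ℚ.* (1ℚ ℚ.+ i ℚ.* γ)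
    expand = Solver.solve-∀ ℚ-ring

  -- Over `Q = 1 / γ` rounds the Bernoulli factor is 2.
  halving : ∀ Q → ι Q ℚ.* γ ≡ 1ℚ → ∀ i → z (i * Q) ℚ.* ι (2 ^ i) ℚ.≤ z 0
  halving Q Qγ≡1 zero    = ℚₚ.≤-reflexive (trans (cong (z 0 ℚ.*_) ι-1) (ℚₚ.*-identityʳ (z 0)))
  halving Q Qγ≡1 (suc i) = begin
    z (Q + i * Q) ℚ.* ι (2 * 2 ^ i)
      ≡⟨ cong (z (Q + i * Q) ℚ.*_) (trans (ι-* 2 (2 ^ i)) (cong (ℚ._* ι (2 ^ i))
           (trans (ι-+ 1 1) (cong₂ ℚ._+_ ι-1 (trans ι-1 (sym Qγ≡1)))))) ⟩
    z (Q + i * Q) ℚ.* ((1ℚ ℚ.+ ι Q ℚ.* γ) ℚ.* ι (2 ^ i))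
      ≡⟨ sym (ℚₚ.*-assoc (z (Q + i * Q)) _ _) ⟩
    z (Q + i * Q) ℚ.* (1ℚ ℚ.+ ι Q ℚ.* γ) ℚ.* ι (2 ^ i)
      ≤⟨ *-monoʳ (0≤ι (2 ^ i)) (bernoulli Q (i * Q)) ⟩
    z (i * Q) ℚ.* ι (2 ^ i)
      ≤⟨ halving Q Qγ≡1 i ⟩
    z 0 ∎
    where open ℚₚ.≤-Reasoning

-- Choice of parameters

m≤m*k : ∀ m {k} → 1 ≤ k → m ≤ m * k
m≤m*k m 1≤k = ≤-trans (≤-reflexive (sym (*-identityʳ m))) (*-monoʳ-≤ m 1≤k)

m≤k*m : ∀ m {k} → 1 ≤ k → m ≤ k * m
m≤k*m m 1≤k = ≤-trans (≤-reflexive (sym (*-identityˡ m))) (*-monoˡ-≤ m 1≤k)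

module Parameters (A m l : ℕ) (1≤A : 1 ≤ A) (1≤m : 1 ≤ m) (1≤l : 1 ≤ l) where

  -- `Z` is the number of rounds divided by `n`. `L` makes `8 * A * T = n * L`, `M = 1 / r` makes
  -- the total loss `T * δ` equal to `1 / 4m`, and `D` makes `L / D = r`.
  L Z M D : ℕ
  L = 512 * A * A * l
  Z = 2 * l * (32 * A)
  M = 4 * m * (Z * (2 * A * (3 * L)))
  D = L * M

  1≤L : 1 ≤ L
  1≤L = *-mono-≤ (*-mono-≤ (*-mono-≤ {1} {512} (s≤s z≤n) 1≤A) 1≤A) 1≤l

  1≤Z : 1 ≤ Z
  1≤Z = *-mono-≤ (*-mono-≤ {1} {2} (s≤s z≤n) 1≤l) (*-mono-≤ {1} {32} (s≤s z≤n) 1≤A)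

  1≤6AL : 1 ≤ 2 * A * (3 * L)
  1≤6AL = *-mono-≤ (*-mono-≤ {1} {2} (s≤s z≤n) 1≤A) (*-mono-≤ {1} {3} (s≤s z≤n) 1≤L)

  4m≤M : 4 * m ≤ M
  4m≤M = m≤m*k (4 * m) (*-mono-≤ 1≤Z 1≤6AL)

  1≤4m : 1 ≤ 4 * m
  1≤4m = *-mono-≤ {1} {4} (s≤s z≤n) 1≤m

  1≤M : 1 ≤ M
  1≤M = ≤-trans 1≤4m 4m≤M

  Z≤M : Z ≤ M
  Z≤M = ≤-trans (m≤m*k Z 1≤6AL) (m≤k*m (Z * (2 * A * (3 * L))) 1≤4m)

  L≤D : L ≤ D
  L≤D = m≤m*k L 1≤M

  1≤D : 1 ≤ D
  1≤D = ≤-trans 1≤L L≤D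

-- At this size of `n` the exposure cost `2 * A * L * (D + 4) / n` is at most `1 / M`; the other
-- size conditions follow.
requiredSize : ℕ → ℕ → ℕ → ℕ
requiredSize A m l = 2 * A * (L * (D + 4)) * M
  where
  L = 512 * A * A * l
  M = 4 * m * (2 * l * (32 * A) * (2 * A * (3 * L)))
  D = L * M

-- `L`, `M` and `D` have degrees 1, 2 and 3 in `l`, which gives degree 6 for the product.
requiredSize≤polylog : ∀ A m → 1 ≤ A → 1 ≤ m → ∃ λ C → ∀ l → 1 ≤ l → requiredSize A m l ≤ C * l ^ 6
requiredSize≤polylog A m 1≤A 1≤m = 10 * A * (a * a) * (μ * μ) , bound
  where
  a = 512 * A * A
  μ = 4 * m * (2 * (32 * A) * (2 * A * (3 * a)))
  M≡ : ∀ m l A a → 4 * m * (2 * l * (32 * A) * (2 * A * (3 * (a * l)))) ≡ 4 * m * (2 * (32 * A) * (2 * A * (3 * a))) * (l * l)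
  M≡ = solve-∀
  degree : ∀ A a l μ → 2 * A * (a * l * (5 * (a * l * (μ * (l * l))))) * (μ * (l * l)) ≡ 10 * A * (a * a) * (μ * μ) * (l * (l * (l * (l * (l * (l * 1))))))
  degree = solve-∀
  bound : ∀ l → 1 ≤ l → requiredSize A m l ≤ 10 * A * (a * a) * (μ * μ) * l ^ 6
  bound l 1≤l = begin
    2 * A * (L * (D + 4)) * M
      ≤⟨ *-monoˡ-≤ M (*-monoʳ-≤ (2 * A) (*-monoʳ-≤ L D+4≤5D)) ⟩
    2 * A * (L * (5 * D)) * M
      ≡⟨ cong (λ M → 2 * A * (L * (5 * (L * M))) * M) (M≡ m l A a) ⟩
    2 * A * (L * (5 * (L * (μ * (l * l))))) * (μ * (l * l))
      ≡⟨ degree A a l μ ⟩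
    10 * A * (a * a) * (μ * μ) * l ^ 6 ∎
    where
    open ≤-Reasoning
    open Parameters A m l 1≤A 1≤m 1≤l
    D+4≤5D : D + 4 ≤ 5 * D
    D+4≤5D = +-monoʳ-≤ D (m≤m*k 4 1≤D)

-- Verification of the conditions on the parameters

module Assembly (A m n : ℕ) (1≤A : 1 ≤ A) (1≤m : 1 ≤ m) (1≤l : 1 ≤ ⌊log₂ n ⌋)
  (size : requiredSize A m ⌊log₂ n ⌋ ≤ n) (G : Graph n)
  (codegree : ∀ u v → u ≢ v → n ≤ A * codeg G u v) (B : Strategy n) (v₀ : Fin n)
  (ε : ℚ) (1≤mε : 1ℚ ℚ.≤ ι m ℚ.* ε) where

  l : ℕ
  l = ⌊log₂ n ⌋

  open Parameters A m l 1≤A 1≤m 1≤l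

  -- `Q` rounds halve the weight `y`, and `2 * l` halvings outweigh `n * n` up to a factor 4. `R`
  -- equals `2 * L`.
  T R Q : ℕ
  Q = 32 * A * n
  T = 2 * l * Q
  R = 1024 * A * A * l

  private
    product≤n : ∀ {a b} → a ≤ 2 * A * (L * (D + 4)) → b ≤ M → a * b ≤ n
    product≤n a≤ b≤ = ≤-trans (*-mono-≤ a≤ b≤) size

    D+4≤ : D + 4 ≤ L * (D + 4)
    D+4≤ = m≤k*m (D + 4) 1≤L

    4≤ : 4 ≤ L * (D + 4)
    4≤ = ≤-trans (m≤n+m 4 D) D+4≤

    32m≤n : 2 * 1 * 4 * (4 * m) ≤ n
    32m≤n = product≤n (*-mono-≤ (*-monoʳ-≤ 2 1≤A) 4≤) 4m≤M

    3≤n : 3 ≤ n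
    3≤n = ≤-trans {3} {2 * 1 * 4 * (4 * 1)} (s≤s (s≤s (s≤s z≤n))) (≤-trans (*-monoʳ-≤ 8 (*-monoʳ-≤ 4 1≤m)) 32m≤n)

    1≤n : 1 ≤ n
    1≤n = ≤-trans (s≤s z≤n) 3≤n

    8A≤n : 8 * A ≤ n
    8A≤n = ≤-trans (≤-reflexive (regroup A)) (product≤n {b = 1} (*-monoʳ-≤ (2 * A) 4≤) 1≤M)
      where
      regroup : ∀ A → 8 * A ≡ 2 * A * 4 * 1
      regroup = solve-∀

    D-small : 4 * A * (D + 4) ≤ 2 * n
    D-small = ≤-trans (≤-reflexive (regroup A (D + 4))) (*-monoʳ-≤ 2 (product≤n {b = 1} (*-monoʳ-≤ (2 * A) D+4≤) 1≤M))
      where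
      regroup : ∀ A d → 4 * A * d ≡ 2 * (2 * A * d * 1)
      regroup = solve-∀

    M≤n : M ≤ n
    M≤n = ≤-trans (m≤k*m M (*-mono-≤ (*-mono-≤ {1} {2} (s≤s z≤n) 1≤A) (≤-trans (s≤s z≤n) 4≤))) size

    T≡Zn : T ≡ Z * n
    T≡Zn = regroup A l n
      where
      regroup : ∀ A l n → 2 * l * (32 * A * n) ≡ 2 * l * (32 * A) * n
      regroup = solve-∀

    T≤n*n : T ≤ n * n
    T≤n*n = ≤-trans (≤-reflexive T≡Zn) (*-monoˡ-≤ n (≤-trans Z≤M M≤n))

    2L≤R : 2 * L ≤ R
    2L≤R = ≤-reflexive (regroup A l)
      where
      regroup : ∀ A l → 2 * (512 * A * A * l) ≡ 1024 * A * A * l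
      regroup = solve-∀

    32A≤R : 32 * A ≤ R
    32A≤R = ≤-trans (*-monoˡ-≤ A {32} {1024} (m≤m+n 32 992)) (≤-trans (m≤m*k (1024 * A) 1≤A) (m≤m*k (1024 * A * A) 1≤l))

    bad-count : 8 * A * T ≤ n * L
    bad-count = ≤-reflexive (regroup A l n)
      where
      regroup : ∀ A l n → 8 * A * (2 * l * (32 * A * n)) ≡ n * (512 * A * A * l)
      regroup = solve-∀

  private
    K : ℕ
    K = 16 * A * n

    1≤K : 1 ≤ K
    1≤K = *-mono-≤ (*-mono-≤ {1} {16} (s≤s z≤n) 1≤A) 1≤n

    Q≡K+K : Q ≡ K + K
    Q≡K+K = regroup A n
      where
      regroup : ∀ A n → 32 * A * n ≡ 16 * A * n + 16 * A * n
      regroup = solve-∀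

    n*n≤ : n * n ≤ 4 * 2 ^ (2 * l)
    n*n≤ = ≤-trans (*-mono-≤ (n≤2*2^log n) (n≤2*2^log n)) (≤-reflexive (trans (regroup (2 ^ l))
      (cong (4 *_) (trans (sym (^-distribˡ-+-* 2 l l)) (cong (λ k → 2 ^ (l + k)) (sym (+-identityʳ l)))))))
      where
      regroup : ∀ x → 2 * x * (2 * x) ≡ 4 * (x * x)
      regroup = solve-∀

    ι-double : ∀ k p → ι (k + k) ℚ.* p ≡ ι k ℚ.* (p ℚ.+ p)
    ι-double k p = trans (cong (ℚ._* p) (ι-+ k k)) (distribute (ι k) p)
      where
      distribute : ∀ i p → (i ℚ.+ i) ℚ.* p ≡ i ℚ.* (p ℚ.+ p)
      distribute = Solver.solve-∀ ℚ-ring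

    ι2 : ∀ p → p ℚ.+ p ≡ ι 2 ℚ.* p
    ι2 p = sym (trans (ι-double 1 p) (trans (cong (ℚ._* (p ℚ.+ p)) ι-1) (ℚₚ.*-identityˡ (p ℚ.+ p))))

    ι3 : ∀ p → p ℚ.+ p ℚ.+ p ≡ ι 3 ℚ.* p
    ι3 p = sym (trans (cong (ℚ._* p) (trans (ι-+ 2 1) (cong (ι 2 ℚ.+_) ι-1)))
      (trans (ℚₚ.*-distribʳ-+ p (ι 2) 1ℚ) (cong₂ ℚ._+_ (sym (ι2 p)) (ℚₚ.*-identityˡ p))))

  -- The four rationals are the reciprocals of `n`, `Q`, `M` and `4 * m`, used only through these
  -- equations.
  module Bounds (ν γ r η : ℚ) (0≤ν : 0ℚ ℚ.≤ ν) (0≤γ : 0ℚ ℚ.≤ γ) (0≤r : 0ℚ ℚ.≤ r)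
    (nν≡1 : ι n ℚ.* ν ≡ 1ℚ) (Qγ≡1 : ι Q ℚ.* γ ≡ 1ℚ) (Mr≡1 : ι M ℚ.* r ≡ 1ℚ)
    (4mη≡1 : ι (4 * m) ℚ.* η ≡ 1ℚ) where

    open ℚₚ.≤-Reasoning

    q c a : ℚ
    q = 1ℚ ℚ.+ ℚ.- γ
    c = ν ℚ.+ ν
    a = ι (2 * A) ℚ.* ν

    K2γ≡1 : ι K ℚ.* (γ ℚ.+ γ) ≡ 1ℚ
    K2γ≡1 = trans (sym (ι-double K γ)) (trans (cong (λ k → ι k ℚ.* γ) (sym Q≡K+K)) Qγ≡1)

    0≤2γ : 0ℚ ℚ.≤ γ ℚ.+ γ
    0≤2γ = 0≤+ 0≤γ 0≤γ

    2γ≤1 : γ ℚ.+ γ ℚ.≤ 1ℚ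
    2γ≤1 = begin
      γ ℚ.+ γ            ≡⟨ sym (trans (cong (ℚ._* (γ ℚ.+ γ)) ι-1) (ℚₚ.*-identityˡ (γ ℚ.+ γ))) ⟩
      ι 1 ℚ.* (γ ℚ.+ γ)  ≤⟨ *-monoʳ 0≤2γ (ι-mono 1≤K) ⟩
      ι K ℚ.* (γ ℚ.+ γ)  ≡⟨ K2γ≡1 ⟩
      1ℚ                 ∎

    0≤q : 0ℚ ℚ.≤ q
    0≤q = begin
      0ℚ             ≡⟨ sym (ℚₚ.+-inverseʳ γ) ⟩
      γ ℚ.+ ℚ.- γ    ≤⟨ ℚₚ.+-monoˡ-≤ (ℚ.- γ) (ℚₚ.≤-trans (p≤p+q {γ} 0≤γ) 2γ≤1) ⟩
      1ℚ ℚ.+ ℚ.- γ   ∎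

    q≤1 : q ℚ.≤ 1ℚ
    q≤1 = begin
      1ℚ ℚ.+ ℚ.- γ            ≤⟨ p≤p+q 0≤γ ⟩
      1ℚ ℚ.+ ℚ.- γ ℚ.+ γ      ≡⟨ cancel γ ⟩
      1ℚ                      ∎
      where
      cancel : ∀ γ → 1ℚ ℚ.+ ℚ.- γ ℚ.+ γ ≡ 1ℚ
      cancel = Solver.solve-∀ ℚ-ring

    -- The hypothesis bounds `S` by `(1 - 1 / K) * X`. As `1 / K = 2γ`, the square of `q = 1 - γ`
    -- exceeds this factor by `γ * γ`.
    decay : ∀ S X → K * S + X ≤ K * X → ι S ℚ.≤ q ℚ.* (q ℚ.* ι X)
    decay S X h = begin
      ι S
        ≡⟨ isolate (ι S) ((γ ℚ.+ γ) ℚ.* ι X) ⟩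
      1ℚ ℚ.* ι S ℚ.+ (γ ℚ.+ γ) ℚ.* ι X ℚ.+ ℚ.- ((γ ℚ.+ γ) ℚ.* ι X)
        ≤⟨ ℚₚ.+-monoˡ-≤ (ℚ.- ((γ ℚ.+ γ) ℚ.* ι X)) (begin
          1ℚ ℚ.* ι S ℚ.+ (γ ℚ.+ γ) ℚ.* ι X
            ≡⟨ cong (λ u → u ℚ.* ι S ℚ.+ (γ ℚ.+ γ) ℚ.* ι X) (sym K2γ≡1) ⟩
          ι K ℚ.* (γ ℚ.+ γ) ℚ.* ι S ℚ.+ (γ ℚ.+ γ) ℚ.* ι X
            ≡⟨ gather (ι K) (γ ℚ.+ γ) (ι S) (ι X) ⟩
          (γ ℚ.+ γ) ℚ.* (ι K ℚ.* ι S ℚ.+ ι X)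
            ≡⟨ cong ((γ ℚ.+ γ) ℚ.*_) (sym (trans (ι-+ (K * S) X) (cong (ℚ._+ ι X) (ι-* K S)))) ⟩
          (γ ℚ.+ γ) ℚ.* ι (K * S + X)
            ≤⟨ *-monoˡ 0≤2γ (ι-mono h) ⟩
          (γ ℚ.+ γ) ℚ.* ι (K * X)
            ≡⟨ trans (cong ((γ ℚ.+ γ) ℚ.*_) (ι-* K X)) (rotate (γ ℚ.+ γ) (ι K) (ι X)) ⟩
          ι K ℚ.* (γ ℚ.+ γ) ℚ.* ι X
            ≡⟨ cong (ℚ._* ι X) K2γ≡1 ⟩
          1ℚ ℚ.* ι X ∎) ⟩
      1ℚ ℚ.* ι X ℚ.+ ℚ.- ((γ ℚ.+ γ) ℚ.* ι X)
        ≤⟨ p≤p+q (0≤* (0≤* 0≤γ 0≤γ) (0≤ι X)) ⟩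
      1ℚ ℚ.* ι X ℚ.+ ℚ.- ((γ ℚ.+ γ) ℚ.* ι X) ℚ.+ γ ℚ.* γ ℚ.* ι X
        ≡⟨ square γ (ι X) ⟩
      q ℚ.* (q ℚ.* ι X) ∎
      where
      isolate : ∀ s x → s ≡ 1ℚ ℚ.* s ℚ.+ x ℚ.+ ℚ.- x
      isolate = Solver.solve-∀ ℚ-ring
      gather : ∀ k g s x → k ℚ.* g ℚ.* s ℚ.+ g ℚ.* x ≡ g ℚ.* (k ℚ.* s ℚ.+ x)
      gather = Solver.solve-∀ ℚ-ring
      rotate : ∀ g k x → g ℚ.* (k ℚ.* x) ≡ k ℚ.* g ℚ.* x
      rotate = Solver.solve-∀ ℚ-ring
      square : ∀ γ x → 1ℚ ℚ.* x ℚ.+ ℚ.- ((γ ℚ.+ γ) ℚ.* x) ℚ.+ γ ℚ.* γ ℚ.* x ≡ (1ℚ ℚ.+ ℚ.- γ) ℚ.* ((1ℚ ℚ.+ ℚ.- γ) ℚ.* x)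
      square = Solver.solve-∀ ℚ-ring

    1≤qcn : 1ℚ ℚ.≤ q ℚ.* c ℚ.* ι n
    1≤qcn = begin
      1ℚ
        ≤⟨ p≤p+q (begin
          0ℚ                               ≡⟨ sym (ℚₚ.+-inverseʳ (γ ℚ.+ γ)) ⟩
          γ ℚ.+ γ ℚ.+ ℚ.- (γ ℚ.+ γ)        ≤⟨ ℚₚ.+-monoˡ-≤ (ℚ.- (γ ℚ.+ γ)) 2γ≤1 ⟩
          1ℚ ℚ.+ ℚ.- (γ ℚ.+ γ)             ∎) ⟩
      1ℚ ℚ.+ (1ℚ ℚ.+ ℚ.- (γ ℚ.+ γ))
        ≡⟨ regroup γ ⟩
      (q ℚ.+ q) ℚ.* 1ℚ
        ≡⟨ cong ((q ℚ.+ q) ℚ.*_) (sym nν≡1) ⟩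
      (q ℚ.+ q) ℚ.* (ι n ℚ.* ν)
        ≡⟨ commute q (ι n) ν ⟩
      q ℚ.* c ℚ.* ι n ∎
      where
      regroup : ∀ γ → 1ℚ ℚ.+ (1ℚ ℚ.+ ℚ.- (γ ℚ.+ γ)) ≡ (1ℚ ℚ.+ ℚ.- γ ℚ.+ (1ℚ ℚ.+ ℚ.- γ)) ℚ.* 1ℚ
      regroup = Solver.solve-∀ ℚ-ring
      commute : ∀ q n ν → (q ℚ.+ q) ℚ.* (n ℚ.* ν) ≡ q ℚ.* (ν ℚ.+ ν) ℚ.* n
      commute = Solver.solve-∀ ℚ-ring

    0≤a : 0ℚ ℚ.≤ a
    0≤a = 0≤* (0≤ι (2 * A)) 0≤ν

    1≤da : ∀ d → n ≤ 2 * A * d → 1ℚ ℚ.≤ ι d ℚ.* a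
    1≤da d n≤ = begin
      1ℚ                            ≡⟨ sym nν≡1 ⟩
      ι n ℚ.* ν                     ≤⟨ *-monoʳ 0≤ν (ι-mono n≤) ⟩
      ι (2 * A * d) ℚ.* ν           ≡⟨ cong (ℚ._* ν) (ι-* (2 * A) d) ⟩
      ι (2 * A) ℚ.* ι d ℚ.* ν       ≡⟨ commute (ι (2 * A)) (ι d) ν ⟩
      ι d ℚ.* a                     ∎
      where
      commute : ∀ x d ν → x ℚ.* d ℚ.* ν ≡ d ℚ.* (x ℚ.* ν)
      commute = Solver.solve-∀ ℚ-ring

    L≤dr : ∀ d → D ≤ d → ι L ℚ.≤ ι d ℚ.* r
    L≤dr d D≤d = begin
      ι L                       ≡⟨ sym (trans (cong (ι L ℚ.*_) Mr≡1) (ℚₚ.*-identityʳ (ι L))) ⟩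
      ι L ℚ.* (ι M ℚ.* r)       ≡⟨ sym (trans (cong (ℚ._* r) (ι-* L M)) (ℚₚ.*-assoc (ι L) (ι M) r)) ⟩
      ι D ℚ.* r                 ≤⟨ *-monoʳ 0≤r (ι-mono D≤d) ⟩
      ι d ℚ.* r                 ∎

    exposure-cost : a ℚ.* ι (L * (D + 4)) ℚ.≤ r
    exposure-cost = begin
      a ℚ.* ι (L * (D + 4))
        ≡⟨ trans (commute (ι (2 * A)) ν (ι (L * (D + 4)))) (cong (λ x → x ℚ.* ν ℚ.* 1ℚ) (sym (ι-* (2 * A) (L * (D + 4))))) ⟩
      ι X ℚ.* ν ℚ.* 1ℚ
        ≡⟨ cong (ι X ℚ.* ν ℚ.*_) (sym Mr≡1) ⟩
      ι X ℚ.* ν ℚ.* (ι M ℚ.* r)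
        ≡⟨ trans (swap (ι X) ν (ι M) r) (cong (λ x → x ℚ.* (ν ℚ.* r)) (sym (ι-* X M))) ⟩
      ι (X * M) ℚ.* (ν ℚ.* r)
        -- `X * M` is the required size.
        ≤⟨ *-monoʳ (0≤* 0≤ν 0≤r) (ι-mono size) ⟩
      ι n ℚ.* (ν ℚ.* r)
        ≡⟨ trans (sym (ℚₚ.*-assoc (ι n) ν r)) (trans (cong (ℚ._* r) nν≡1) (ℚₚ.*-identityˡ r)) ⟩
      r ∎
      where
      X = 2 * A * (L * (D + 4))
      commute : ∀ x ν y → x ℚ.* ν ℚ.* y ≡ x ℚ.* y ℚ.* ν ℚ.* 1ℚ
      commute = Solver.solve-∀ ℚ-ring
      swap : ∀ x ν m r → x ℚ.* ν ℚ.* (m ℚ.* r) ≡ x ℚ.* m ℚ.* (ν ℚ.* r)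
      swap = Solver.solve-∀ ℚ-ring

    open Certificate G B A T L D R 3≤n 8A≤n 1≤L L≤D 2L≤R 32A≤R codegree bad-count D-small
      q c a r 0≤q q≤1 (0≤+ 0≤ν 0≤ν) 0≤a 0≤r decay 1≤qcn 1≤da L≤dr exposure-cost
    open Decay γ 0≤γ y 0≤y (λ _ → refl) using (halving)
    open Potential G using (expectedUnv; expectedUnv≤)

    ≤η : ∀ {x} → ι (4 * m) ℚ.* x ℚ.≤ 1ℚ → x ℚ.≤ η
    ≤η h = *-cancelˡ 1≤4m (ℚₚ.≤-trans h (ℚₚ.≤-reflexive (sym 4mη≡1)))

    -- The `2 * l` halvings bring `c * n * n` down to at most `4 * c = 8 / n`, which is at most
    -- `1 / 4m` because `32 * m ≤ n`.
    yF≤η : ∀ {x} → x ≤ n * n → y (suc T) ℚ.* ι x ℚ.≤ η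
    yF≤η {x} x≤ = ≤η (begin
      ι (4 * m) ℚ.* (y (suc T) ℚ.* ι x)
        ≤⟨ *-monoˡ (0≤ι (4 * m)) (begin
          y (suc T) ℚ.* ι x
            ≤⟨ ℚₚ.≤-trans (*-monoʳ (0≤ι x) (y-decreasing T)) (*-monoˡ (0≤y T) (ι-mono (≤-trans x≤ n*n≤))) ⟩
          y T ℚ.* ι (4 * 2 ^ (2 * l))
            ≡⟨ trans (cong (y T ℚ.*_) (ι-* 4 (2 ^ (2 * l)))) (rotate (y T) (ι 4) (ι (2 ^ (2 * l)))) ⟩
          ι 4 ℚ.* (y T ℚ.* ι (2 ^ (2 * l)))
            ≤⟨ *-monoˡ (0≤ι 4) (halving Q Qγ≡1 (2 * l)) ⟩
          ι 4 ℚ.* c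
            ≡⟨ cong (ι 4 ℚ.*_) (ι2 ν) ⟩
          ι 4 ℚ.* (ι 2 ℚ.* ν)
            ≡⟨ trans (sym (ℚₚ.*-assoc (ι 4) (ι 2) ν)) (cong (ℚ._* ν) (sym (ι-* 4 2))) ⟩
          ι 8 ℚ.* ν ∎) ⟩
      ι (4 * m) ℚ.* (ι 8 ℚ.* ν)
        ≡⟨ trans (swap (ι (4 * m)) (ι 8) ν) (cong (ℚ._* ν) (sym (ι-* 8 (4 * m)))) ⟩
      ι (8 * (4 * m)) ℚ.* ν
        ≤⟨ *-monoʳ 0≤ν (ι-mono 32m≤n) ⟩
      ι n ℚ.* ν
        ≡⟨ nν≡1 ⟩
      1ℚ ∎)
      where
      rotate : ∀ x y z → x ℚ.* (y ℚ.* z) ≡ y ℚ.* (x ℚ.* z)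
      rotate = Solver.solve-∀ ℚ-ring
      swap : ∀ x y z → x ℚ.* (y ℚ.* z) ≡ y ℚ.* x ℚ.* z
      swap = Solver.solve-∀ ℚ-ring

    Tδ≤η : ι T ℚ.* δ ℚ.≤ η
    Tδ≤η = ≤η (ℚₚ.≤-reflexive (begin-equality
      ι (4 * m) ℚ.* (ι T ℚ.* (ι (2 * A) ℚ.* ν ℚ.* ((r ℚ.+ r ℚ.+ r) ℚ.* ι L)))
        ≡⟨ cong₂ (λ t s → ι (4 * m) ℚ.* (t ℚ.* (ι (2 * A) ℚ.* ν ℚ.* (s ℚ.* ι L)))) (trans (cong ι T≡Zn) (ι-* Z n)) (ι3 r) ⟩
      ι (4 * m) ℚ.* (ι Z ℚ.* ι n ℚ.* (ι (2 * A) ℚ.* ν ℚ.* (ι 3 ℚ.* r ℚ.* ι L)))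
        ≡⟨ regroup (ι (4 * m)) (ι Z) (ι n) (ι (2 * A)) ν (ι 3) r (ι L) ⟩
      ι (4 * m) ℚ.* (ι Z ℚ.* (ι (2 * A) ℚ.* (ι 3 ℚ.* ι L))) ℚ.* r ℚ.* (ι n ℚ.* ν)
        ≡⟨ cong₂ (λ x y → x ℚ.* r ℚ.* y) (sym ιM) nν≡1 ⟩
      ι M ℚ.* r ℚ.* 1ℚ
        ≡⟨ trans (ℚₚ.*-identityʳ (ι M ℚ.* r)) Mr≡1 ⟩
      1ℚ ∎))
      where
      ιM : ι M ≡ ι (4 * m) ℚ.* (ι Z ℚ.* (ι (2 * A) ℚ.* (ι 3 ℚ.* ι L)))
      ιM = trans (ι-* (4 * m) _) (cong (ι (4 * m) ℚ.*_) (trans (ι-* Z _) (cong (ι Z ℚ.*_)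
        (trans (ι-* (2 * A) _) (cong (ι (2 * A) ℚ.*_) (ι-* 3 L))))))
      regroup : ∀ f z n a ν t r L →
        f ℚ.* (z ℚ.* n ℚ.* (a ℚ.* ν ℚ.* (t ℚ.* r ℚ.* L))) ≡ f ℚ.* (z ℚ.* (a ℚ.* (t ℚ.* L))) ℚ.* r ℚ.* (n ℚ.* ν)
      regroup = Solver.solve-∀ ℚ-ring

    r≤η : r ℚ.≤ η
    r≤η = ≤η (ℚₚ.≤-trans (*-monoʳ 0≤r (ι-mono 4m≤M)) (ℚₚ.≤-reflexive Mr≡1))

    -- The three failure terms together amount to `3 / 4m`, below `1 / m ≤ ε`.
    3η≤ε : η ℚ.+ η ℚ.+ η ℚ.≤ ε
    3η≤ε = *-cancelˡ 1≤4m (begin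
      ι (4 * m) ℚ.* (η ℚ.+ η ℚ.+ η)
        ≡⟨ trans (cong (ι (4 * m) ℚ.*_) (ι3 η)) (swap (ι (4 * m)) (ι 3) η) ⟩
      ι 3 ℚ.* (ι (4 * m) ℚ.* η)
        ≡⟨ cong (ι 3 ℚ.*_) 4mη≡1 ⟩
      ι 3 ℚ.* 1ℚ
        ≤⟨ *-monoʳ (ℚₚ.nonNegative⁻¹ 1ℚ) (ι-mono {3} {4} (n≤1+n 3)) ⟩
      ι 4 ℚ.* 1ℚ
        ≤⟨ *-monoˡ (0≤ι 4) 1≤mε ⟩
      ι 4 ℚ.* (ι m ℚ.* ε)
        ≡⟨ trans (sym (ℚₚ.*-assoc (ι 4) (ι m) ε)) (cong (ℚ._* ε) (sym (ι-* 4 m))) ⟩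
      ι (4 * m) ℚ.* ε ∎)
      where
      swap : ∀ x y z → x ℚ.* (y ℚ.* z) ≡ y ℚ.* (x ℚ.* z)
      swap = Solver.solve-∀ ℚ-ring

    open Deficit G B R

    s₀ : State n
    s₀ = st v₀ (v₀ ∷ []) [] []

    j : ℕ
    j = suc (n * n) ∸ T

    fuel : T + j ≡ suc (n * n)
    fuel = m+[n∸m]≡n (≤-trans T≤n*n (n≤1+n (n * n)))

    0≤ε : 0ℚ ℚ.≤ ε
    0≤ε = *-cancelˡ 1≤m (ℚₚ.≤-trans (ℚₚ.≤-reflexive (ℚₚ.*-zeroʳ (ι m))) (ℚₚ.≤-trans (ℚₚ.nonNegative⁻¹ 1ℚ) 1≤mε))

    no-edges-good : 4 * A * bdeg [] v₀ ≤ n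
    no-edges-good = ≤-trans (≤-reflexive (trans (cong (4 * A *_) (∑-zero (allFin n))) (*-zeroʳ (4 * A)))) z≤n

    1≤p+ε : 1ℚ ℚ.≤ probK G (suc (n * n)) B E s₀ ℚ.+ ε
    1≤p+ε = decide (#unv (v₀ ∷ []) ≤? R)
      where
      e = exposed j s₀
      decide : Dec (#unv (v₀ ∷ []) ≤ R) → 1ℚ ℚ.≤ probK G (suc (n * n)) B E s₀ ℚ.+ ε
      decide (yes u≤R) = ℚₚ.≤-trans (1≤probK (suc (n * n)) s₀ u≤R) (p≤p+q 0≤ε)
      decide (no u≰R) = subst (λ k → 1ℚ ℚ.≤ probK G k B E s₀ ℚ.+ ε) fuel
        (slack j {P j T s₀} (proj₁ (certificate j T s₀ ≤-refl (≰⇒> u≰R)) no-edges-good) (begin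
          y (suc T) ℚ.* ι (F j s₀) ℚ.+ (ι T ℚ.* δ ℚ.+ a ℚ.* ι e)
            ≤⟨ ℚₚ.+-mono-≤ (yF≤η (expectedUnv≤ [] (v₀ ∷ []) v₀)) (ℚₚ.+-mono-≤ Tδ≤η
                 (ℚₚ.≤-trans (*-monoˡ 0≤a (ι-mono e≤)) (ℚₚ.≤-trans exposure-cost r≤η))) ⟩
          η ℚ.+ (η ℚ.+ η)
            ≡⟨ sym (ℚₚ.+-assoc η η η) ⟩
          η ℚ.+ η ℚ.+ η
            ≤⟨ 3η≤ε ⟩
          ε ∎))
        where
        open Estimates G A T L D (≤-trans (n≤1+n 2) 3≤n) codegree bad-count D-small using (exposure≤L)
        e≤ : e ≤ L * (D + 4)
        e≤ = ≤-trans (exposure≤L [] v₀ z≤n) (m≤m*k L (≤-trans 1≤D (m≤m+n D 4)))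

  win : 1ℚ ℚ.≤ gameProb G B v₀ (λ k → (n ∸ R) ≤ᵇ k) ℚ.+ ε
  win =
    let ν , 0≤ν , nν  = reciprocal 1≤n
        γ , 0≤γ , Qγ  = reciprocal {Q} (*-mono-≤ (*-mono-≤ {1} {32} (s≤s z≤n) 1≤A) 1≤n)
        r , 0≤r , Mr  = reciprocal 1≤M
        η , _   , 4mη = reciprocal 1≤4m
    in Bounds.1≤p+ε ν γ r η 0≤ν 0≤γ 0≤r nν Qγ Mr 4mη

-- Passage from rational hypotheses to the theorem

codegree-in-ℕ : ∀ {n} (G : Graph n) A α → 1ℚ ℚ.≤ ι A ℚ.* α → CodegreeAtLeast α G →
  ∀ u v → u ≢ v → n ≤ A * codeg G u v
codegree-in-ℕ {n} G A α 1≤Aα cod u v u≢v = ι-cancel-≤ (begin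
  ι n                       ≡⟨ sym (ℚₚ.*-identityˡ (ι n)) ⟩
  1ℚ ℚ.* ι n                ≤⟨ *-monoʳ (0≤ι n) 1≤Aα ⟩
  ι A ℚ.* α ℚ.* ι n         ≡⟨ ℚₚ.*-assoc (ι A) α (ι n) ⟩
  ι A ℚ.* (α ℚ.* ι n)       ≤⟨ *-monoˡ (0≤ι A) (subst₂ (λ x y → α ℚ.* x ℚ.≤ y) (sym (ι≡/ n)) (sym (ι≡/ (codeg G u v))) (cod u v u≢v)) ⟩
  ι A ℚ.* ι (codeg G u v)   ≡⟨ sym (ι-* A (codeg G u v)) ⟩
  ι (A * codeg G u v)       ∎)
  where open ℚₚ.≤-Reasoning

theorem5 : (α : ℚ) → 0ℚ ℚ.< α →
    Σ ℕ (λ c → (0 ℕ.< c) ×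
    ((ε : ℚ) → 0ℚ ℚ.< ε → Σ ℕ (λ N → (n : ℕ) → N ≤ n →
    (G : Graph n) → CodegreeAtLeast α G →
    (v : Fin n) → (B : Strategy n) →
    1ℚ ℚ.- ε ℚ.≤ gameProb G B v (λ k → (n ∸ c * ⌊log₂ n ⌋) ≤ᵇ k))))
theorem5 α 0<α =
  let A , 1≤A , 1≤Aα = archimedean α 0<α in
  -- This constant comes from `R = 2 * L`; `ε` enters only through `m`, hence only through `M`, `D`
  -- and the threshold `N`.
  1024 * A * A , *-mono-≤ (*-mono-≤ {1} {1024} (s≤s z≤n) 1≤A) 1≤A , λ ε 0<ε →
  let m , 1≤m , 1≤mε = archimedean ε 0<ε
      C , required   = requiredSize≤polylog A m 1≤A 1≤m
      N , large      = polylog≤n C 6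
  in N , λ n N≤n G cod v B →
  let 1≤l , Cl≤n = large n N≤n
  in transpose (Assembly.win A m n 1≤A 1≤m 1≤l (≤-trans (required ⌊log₂ n ⌋ 1≤l) Cl≤n) G (codegree-in-ℕ G A α 1≤Aα cod) B v ε 1≤mε)
  where
  transpose : ∀ {p ε} → 1ℚ ℚ.≤ p ℚ.+ ε → 1ℚ ℚ.- ε ℚ.≤ p
  transpose {p} {ε} h = ℚₚ.≤-trans (ℚₚ.+-monoˡ-≤ (ℚ.- ε) h) (ℚₚ.≤-reflexive
    (trans (ℚₚ.+-assoc p ε (ℚ.- ε)) (trans (cong (p ℚ.+_) (ℚₚ.+-inverseʳ ε)) (ℚₚ.+-identityʳ p))))
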